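{- Let $k$ be a positive integer and $\beta \ge \alpha > 0$. There is $\varepsilon_0>0$ such that the following holds for every $0<\varepsilon\le\varepsilon_0$. Set $\delta = \frac{\varepsilon}{2}\left(\frac{\alpha}{16\beta}\right)^{2k}$, let $n>0$ and let $N \le \beta n$ be a positive integer. Suppose that $G$ is a $k$-coloured graph on at least $N + \varepsilon n$ vertices in which every vertex has at most $\delta n$ non-neighbours, and $G$ contains no monochromatic connected matching on at least $\alpha n$ vertices. Then there exists a $k$-colouring $G'$ of $K_N$ that contains no monochromatic connected matching on at least $\alpha n$ vertices. Moreover, there exists such a $G'$ containing an induced subgraph of $G$ on $N$ vertices, i.e. $V(G')$ is a set $S\subseteq V(G)$ of size $N$ and every edge of $G[S]$ has in $G'$ the colour it has in $G$.
   Context: A $k$-coloured graph is a graph each of whose edges is assigned one of $k$ colours; a $k$-colouring of $K_N$ is such an assignment on the complete graph. For a colour $\ell$, an $\ell$-coloured component is a connected component of the graph formed by the edges of colour $\ell$. A monochromatic connected matching is a matching all of whose edges have the same colour $\ell$ and lie in a single $\ell$-coloured component; it is on at least $t$ vertices if it covers at least $t$ vertices.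
   Formalization: The parameters α, β, ε, ε₀ and n are taken to be rational numbers instead of real numbers. -}

module Defs where

open import Data.Nat as ℕ using (ℕ; zero; suc)
open import Data.Fin using (Fin; _≟_)
open import Data.Fin.Properties using () renaming (_≟_ to _≟F_)
open import Data.Maybe using (Maybe; just; nothing)
import Data.Maybe.Properties as MaybeP
open import Data.List using (List; []; _∷_; length; filter; concatMap)
open import Data.List.Relation.Unary.All using (All)
open import Data.List.Relation.Unary.Unique.Propositional using (Unique)
open import Data.Fin using () renaming (_≟_ to _≟Fin_)
open import Data.List using () renaming (_++_ to _++L_)
open import Data.Vec.Functional using ()
open import Data.List.Base using ()
open import Data.Fin.Base using ()
open import Data.Integer using (+_)
open import Data.Rational using (ℚ; 1ℚ; _*_; _÷_; _≤_; _/_; Positive; positive; _<_; 0ℚ)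
open import Data.Rational.Properties using (pos⇒nonZero)
open import Data.Product using (Σ; _×_; _,_; ∃)
open import Relation.Binary.PropositionalEquality using (_≡_; _≢_)
open import Relation.Nullary using (¬_; ¬?)
open import Relation.Nullary.Decidable using (_×-dec_)
import Data.List as L

-- A k-coloured graph on the vertex set Fin M:
-- col u v = just ℓ  means uv is an edge of colour ℓ,
-- col u v = nothing means u and v are not adjacent.
record ColGraph (k M : ℕ) : Set where
  field
    col    : Fin M → Fin M → Maybe (Fin k)
    sym    : ∀ u v → col u v ≡ col v u
    irrefl : ∀ u → col u u ≡ nothing
open ColGraph public

Complete : ∀ {k M} → ColGraph k M → Set
Complete G = ∀ u v → u ≢ v → col G u v ≢ nothing

nonNeighbours : ∀ {k M} → ColGraph k M → Fin M → List (Fin M)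
nonNeighbours {k} {M} G u =
  filter (λ v → ¬? (v ≟Fin u) ×-dec MaybeP.≡-dec _≟Fin_ (col G u v) nothing) (L.allFin M)

data Reach {k M : ℕ} (G : ColGraph k M) (ℓ : Fin k) : Fin M → Fin M → Set where
  here : ∀ {u} → Reach G ℓ u u
  step : ∀ {u v w} → col G u v ≡ just ℓ → Reach G ℓ v w → Reach G ℓ u w

endpoints : ∀ {M} → List (Fin M × Fin M) → List (Fin M)
endpoints [] = []
endpoints ((u , v) ∷ es) = u ∷ v ∷ endpoints es

record MonoConnMatching {k M : ℕ} (G : ColGraph k M) : Set where
  field
    colour   : Fin k
    edges    : List (Fin M × Fin M)
    coloured : All (λ e → col G (Data.Product.proj₁ e) (Data.Product.proj₂ e) ≡ just colour) edges
    disjoint : Unique (endpoints edges)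
    root     : Fin M
    connected : All (λ v → Reach G colour root v) (endpoints edges)
open MonoConnMatching public

covered : ∀ {k M} {G : ColGraph k M} → MonoConnMatching G → ℕ
covered m = 2 ℕ.* length (edges m)

⟦_⟧ : ℕ → ℚ
⟦ n ⟧ = (+ n) / 1

NoMCM : ∀ {k M} → ColGraph k M → ℚ → Set
NoMCM G t = (m : MonoConnMatching G) → ¬ (t ≤ ⟦ covered m ⟧)

_^_ : ℚ → ℕ → ℚ
p ^ zero  = 1ℚ
p ^ suc n = p * (p ^ n)

delta : (k : ℕ) (α β ε : ℚ) → 0ℚ < β → ℚ
delta k α β ε β>0 =
  (ε * ((+ 1) / 2)) * ((α ÷ (⟦ 16 ⟧ * β)) {{nz}} ^ (2 ℕ.* k))
  where
  nz = pos⇒nonZero (⟦ 16 ⟧ * β) {{Data.Rational.Properties.pos*pos⇒pos ⟦ 16 ⟧ {{_}} β {{positive β>0}}}}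

{-# OPTIONS --safe #-}

-- Let s be the largest size of a matching that is allowed in a monochromatic component.  In each
-- colour, add edges inside the components of that colour as long as no component acquires a matching
-- of size s + 1.  In the resulting graph two non-adjacent vertices of a component are missed by a
-- matching of size s, so Gallai's exchange argument shows that a component consists of vertices
-- adjacent to the whole component together with disjoint cliques.  Adjacency of u and v in such a
-- graph can be expressed as P(u) ∩ Q(v) ≠ ∅ for sets of size at most 2 (the names of the component
-- and of the clique), so over all colours as the intersection of sets of size at most 2k.  Repeatedly
-- pick two vertices u, v that are adjacent in no saturated colour and delete all non-neighbours of
-- u and v in G; by Bollobás's set-pair inequality this stops after at most 2^(4k) rounds, hence at
-- most 2^(4k) · 2δn ≤ εn vertices are lost.  Any two surviving vertices are adjacent in some
-- saturated colour, with which a missing edge can be coloured.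
module Submission where

open import Defs hiding (_^_; edges; sym; irrefl; here; step; root; connected; colour; coloured; disjoint)
open import Data.Bool using (Bool; true; false; not; T)
open import Data.Empty using (⊥)
open import Data.Fin using (Fin; zero; suc) renaming (_≟_ to _≟ᶠ_)
import Data.Fin.Base as Fin
open import Data.Fin.Patterns using (0F; 1F; 2F)
import Data.Fin.Properties as Fin
open import Data.Integer as ℤ using (+_)
import Data.Integer.Properties as ℤ
open import Data.List using (List; []; _∷_; [_]; _++_; length; lookup; map; filter; allFin; cartesianProduct; deduplicate; concatMap)
open import Data.List.Membership.Propositional using (_∈_; _∉_; find; lose)
open import Data.List.Membership.Propositional.Properties using (∈-∃++; ∈-++⁺ˡ; ∈-++⁺ʳ; ∈-++⁻; ∈-filter⁺; ∈-filter⁻; ∈-deduplicate⁺; ∈-concatMap⁺; ∈-concatMap⁻; ∈-map⁺; ∈-map⁻; ∈-lookup; ∈-allFin; ∈-cartesianProduct⁺)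
open import Data.List.Properties using (length-++; length-filter; length-map; length-tabulate)
open import Data.List.Relation.Binary.Permutation.Propositional using (_↭_; ↭-refl; ↭-sym; ↭-trans; prep; swap)
import Data.List.Relation.Binary.Permutation.Propositional.Properties as ↭
open import Data.List.Relation.Binary.Subset.Propositional using (_⊆_)
open import Data.List.Relation.Unary.All as All using (All; []; _∷_)
import Data.List.Relation.Unary.All.Properties as All
open import Data.List.Relation.Unary.AllPairs as AllPairs using (AllPairs; []; _∷_)
import Data.List.Relation.Unary.AllPairs.Properties as AllPairs
open import Data.List.Relation.Unary.Any as Any using (Any; here; there; any?)
import Data.List.Relation.Unary.Unique.DecPropositional.Properties as DecUnique
open import Data.List.Relation.Unary.Unique.Propositional using (Unique)
import Data.List.Relation.Unary.Unique.Propositional.Properties as Unique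
open import Data.Maybe using (Maybe; just; nothing; is-just)
import Data.Maybe.Properties as Maybe
open import Data.Nat as ℕ using (ℕ; zero; suc; z≤n; s≤s; _^_)
open import Data.Nat.ListAction using (sum)
import Data.Nat.Properties as ℕ
open import Data.Product as Product using (Σ; ∃; _×_; _,_; proj₁; proj₂; uncurry)
import Data.Product.Properties as Product
open import Data.Rational as ℚ using (ℚ; 0ℚ; 1ℚ; _≤_; _<_; _+_; _*_)
import Data.Rational.Properties as ℚ
import Data.Rational.Solver as ℚSolver
import Data.Rational.Unnormalised as ℚᵘ
import Data.Rational.Unnormalised.Properties as ℚᵘ
open import Data.Sum as Sum using (_⊎_; inj₁; inj₂)
open import Function using (_∘_; id)
open import Function.Definitions using (Injective)
open import Relation.Binary using (Symmetric; DecidableEquality; tri<; tri≈; tri>) renaming (Decidable to Decidable₂)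
open import Relation.Binary.Construct.Closure.ReflexiveTransitive as Star using (Star; _◅_; _◅◅_)
open import Relation.Binary.PropositionalEquality using (_≡_; _≢_; refl; sym; trans; cong; cong₂; subst; ≢-sym)
open import Relation.Nullary using (¬_; Dec; yes; no; ¬?; contradiction)
open import Relation.Nullary.Decidable using (decidable-stable; _×-dec_; _⊎-dec_; _→-dec_; map′; T?)
open import Relation.Unary using (Decidable)

-- Counting in lists without repetitions

module _ {A : Set} where

  length-mono-⊆ : ∀ {xs ys : List A} → Unique xs → xs ⊆ ys → length xs ℕ.≤ length ys
  length-mono-⊆ {[]}     []            _     = z≤n
  length-mono-⊆ {x ∷ xs} (x∉xs ∷ xs!) sub with ∈-∃++ (sub (here refl))
  ... | as , bs , refl = begin
    suc (length xs)               ≤⟨ s≤s (length-mono-⊆ xs! sub′) ⟩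
    suc (length (as ++ bs))       ≡⟨ cong suc (length-++ as) ⟩
    suc (length as ℕ.+ length bs) ≡⟨ ℕ.+-suc (length as) (length bs) ⟨
    length as ℕ.+ suc (length bs) ≡⟨ length-++ as ⟨
    length (as ++ [ x ] ++ bs)    ∎
    where
    open ℕ.≤-Reasoning
    sub′ : xs ⊆ as ++ bs
    sub′ {y} y∈xs with ∈-++⁻ as (sub (there y∈xs))
    ... | inj₁ y∈as         = ∈-++⁺ˡ y∈as
    ... | inj₂ (here refl)  = contradiction refl (All.lookup x∉xs y∈xs)
    ... | inj₂ (there y∈bs) = ∈-++⁺ʳ as y∈bs

  module _ (_≟_ : DecidableEquality A) where
    open import Data.List.Membership.DecPropositional _≟_ using (_∈?_)

    ∃-∉ : ∀ {xs ys : List A} → Unique xs → length ys ℕ.< length xs → ∃ λ x → x ∈ xs × x ∉ ys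
    ∃-∉ {xs} {ys} xs! ys<xs with any? (λ x → ¬? (x ∈? ys)) xs
    ... | yes some = find some
    ... | no none  = contradiction (length-mono-⊆ xs! sub) (ℕ.<⇒≱ ys<xs)
      where
      sub : xs ⊆ ys
      sub x∈xs = decidable-stable (_ ∈? ys) λ x∉ys → none (lose x∈xs x∉ys)

-- Bollobás's set-pair inequality

module _ {A : Set} where

  -- A partial assignment c : A → Maybe Bool stands for the subcube of {0,1}^xs of its extensions.
  volume : List A → (A → Maybe Bool) → ℕ
  volume []       c = 1
  volume (x ∷ xs) c with c x
  ... | nothing = 2 ℕ.* volume xs c
  ... | just _  = volume xs c

  -- Opposite values at a common coordinate make the two subcubes disjoint.
  Clash : List A → (A → Maybe Bool) → (A → Maybe Bool) → Set
  Clash xs c d = Any (λ x → ∃ λ b → c x ≡ just b × d x ≡ just (not b)) xs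

  allows : Bool → Maybe Bool → Bool
  allows b     nothing      = true
  allows true  (just true)  = true
  allows true  (just false) = false
  allows false (just true)  = false
  allows false (just false) = true

  face : A → Bool → List (A → Maybe Bool) → List (A → Maybe Bool)
  face x b = filter (λ c → T? (allows b (c x)))

  ¬allows-both : ∀ b c {d e} → T (allows b d) → T (allows b e) → d ≡ just c → e ≢ just (not c)
  ¬allows-both true  true  _  () refl refl
  ¬allows-both true  false () _  refl refl
  ¬allows-both false true  () _  refl refl
  ¬allows-both false false _  () refl refl

  total : List A → List (A → Maybe Bool) → ℕ
  total xs cs = sum (map (volume xs) cs)

  -- A subcube that is free at x leaves half of its volume in each of the two faces; one that is
  -- fixed at x lies in a single face.
  total-split : ∀ x xs cs → total (x ∷ xs) cs ≡ total xs (face x true cs) ℕ.+ total xs (face x false cs)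
  total-split x xs [] = refl
  total-split x xs (c ∷ cs) with c x | total-split x xs cs
  ... | just true  | eq = trans (cong (volume xs c ℕ.+_) eq) (sym (ℕ.+-assoc (volume xs c) _ _))
  ... | just false | eq = trans (cong (volume xs c ℕ.+_) eq) (lemma (volume xs c) (total xs (face x true cs)) _)
    where
    open import Data.Nat.Solver using (module +-*-Solver)
    open +-*-Solver
    lemma : ∀ v a b → v ℕ.+ (a ℕ.+ b) ≡ a ℕ.+ (v ℕ.+ b)
    lemma = solve 3 (λ v a b → v :+ (a :+ b) := a :+ (v :+ b)) refl
  ... | nothing    | eq = trans (cong (2 ℕ.* volume xs c ℕ.+_) eq) (lemma (volume xs c) (total xs (face x true cs)) _)
    where
    open import Data.Nat.Solver using (module +-*-Solver)
    open +-*-Solver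
    lemma : ∀ v a b → 2 ℕ.* v ℕ.+ (a ℕ.+ b) ≡ (v ℕ.+ a) ℕ.+ (v ℕ.+ b)
    lemma = solve 3 (λ v a b → con 2 :* v :+ (a :+ b) := (v :+ a) :+ (v :+ b)) refl

  -- Two subcubes that reach the same face do not disagree at x, so their clash must occur at a
  -- later coordinate.
  face-clash : ∀ x b xs cs → AllPairs (Clash (x ∷ xs)) cs → AllPairs (Clash xs) (face x b cs)
  face-clash x b xs cs clash =
    restrict (All.all-filter (λ c → T? (allows b (c x))) cs) (AllPairs.filter⁺ (λ c → T? (allows b (c x))) clash)
    where
    restrict : ∀ {ds} → All (λ c → T (allows b (c x))) ds → AllPairs (Clash (x ∷ xs)) ds → AllPairs (Clash xs) ds
    restrict []       []       = []
    restrict (p ∷ ps) (q ∷ qs) = All.zipWith drop-x (ps , q) ∷ restrict ps qs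
      where
      drop-x : ∀ {d} → T (allows b (d x)) × Clash (x ∷ xs) _ d → Clash xs _ d
      drop-x (p′ , here (v , e , e′)) = contradiction e′ (¬allows-both b v p p′ e)
      drop-x (p′ , there rest)        = rest

  -- Disjoint subcubes have at most the volume of the whole cube. The induction halves the cube;
  -- once no coordinates are left no two subcubes can clash, so at most one remains.
  total≤ : ∀ xs cs → AllPairs (Clash xs) cs → total xs cs ℕ.≤ 2 ^ length xs
  total≤ []       []          _                   = z≤n
  total≤ []       (c ∷ [])    _                   = s≤s z≤n
  total≤ []       (c ∷ d ∷ _) ((() ∷ _) ∷ _)
  total≤ (x ∷ xs) cs          clash = begin
    total (x ∷ xs) cs                                       ≡⟨ total-split x xs cs ⟩
    total xs (face x true cs) ℕ.+ total xs (face x false cs) ≤⟨ ℕ.+-mono-≤ (half true) (half false) ⟩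
    2 ^ length xs ℕ.+ 2 ^ length xs                         ≡⟨ cong (2 ^ length xs ℕ.+_) (ℕ.+-identityʳ _) ⟨
    2 ^ length (x ∷ xs)                                     ∎
    where
    open ℕ.≤-Reasoning
    half : ∀ b → total xs (face x b cs) ℕ.≤ 2 ^ length xs
    half b = total≤ xs (face x b cs) (face-clash x b xs cs clash)

  fixed : (A → Maybe Bool) → List A → List A
  fixed c = filter (λ x → T? (is-just (c x)))

  volume-fixed : ∀ xs c → volume xs c ℕ.* 2 ^ length (fixed c xs) ≡ 2 ^ length xs
  volume-fixed []       c = refl
  volume-fixed (x ∷ xs) c with c x | volume-fixed xs c
  ... | nothing | eq = trans (ℕ.*-assoc 2 (volume xs c) _) (cong (2 ℕ.*_) eq)
  ... | just _  | eq = trans (lemma (volume xs c) (2 ^ length (fixed c xs))) (cong (2 ℕ.*_) eq)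
    where
    open import Data.Nat.Solver using (module +-*-Solver)
    open +-*-Solver
    lemma : ∀ v p → v ℕ.* (2 ℕ.* p) ≡ 2 ℕ.* (v ℕ.* p)
    lemma = solve 2 (λ v p → v :* (con 2 :* p) := con 2 :* (v :* p)) refl

  -- Each subcube fills at least a 2^-d share of the cube and they are disjoint. The common factor
  -- `2 ^ length xs` avoids division.
  subcubes≤ : ∀ d xs cs → AllPairs (Clash xs) cs → All (λ c → length (fixed c xs) ℕ.≤ d) cs → length cs ℕ.≤ 2 ^ d
  subcubes≤ d xs cs clash small = ℕ.*-cancelʳ-≤ (length cs) (2 ^ d) (2 ^ length xs) {{ℕ.m^n≢0 2 (length xs)}} (begin
    length cs ℕ.* 2 ^ length xs ≤⟨ count cs small ⟩
    2 ^ d ℕ.* total xs cs       ≤⟨ ℕ.*-monoʳ-≤ (2 ^ d) (total≤ xs cs clash) ⟩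
    2 ^ d ℕ.* 2 ^ length xs     ∎)
    where
    open ℕ.≤-Reasoning
    count : ∀ cs → All (λ c → length (fixed c xs) ℕ.≤ d) cs → length cs ℕ.* 2 ^ length xs ℕ.≤ 2 ^ d ℕ.* total xs cs
    count []       []       = z≤n
    count (c ∷ cs) (p ∷ ps) = begin
      2 ^ length xs ℕ.+ length cs ℕ.* 2 ^ length xs             ≡⟨ cong (ℕ._+ length cs ℕ.* 2 ^ length xs) (volume-fixed xs c) ⟨
      volume xs c ℕ.* 2 ^ length (fixed c xs) ℕ.+ length cs ℕ.* 2 ^ length xs
        ≤⟨ ℕ.+-mono-≤ (ℕ.*-monoʳ-≤ (volume xs c) (ℕ.^-monoʳ-≤ 2 p)) (count cs ps) ⟩
      volume xs c ℕ.* 2 ^ d ℕ.+ 2 ^ d ℕ.* total xs cs           ≡⟨ cong (ℕ._+ 2 ^ d ℕ.* total xs cs) (ℕ.*-comm (volume xs c) (2 ^ d)) ⟩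
      2 ^ d ℕ.* volume xs c ℕ.+ 2 ^ d ℕ.* total xs cs           ≡⟨ ℕ.*-distribˡ-+ (2 ^ d) (volume xs c) (total xs cs) ⟨
      2 ^ d ℕ.* total xs (c ∷ cs)                               ∎

Meets : ∀ {A : Set} → List A → List A → Set
Meets xs ys = ∃ λ x → x ∈ xs × x ∈ ys

module _ {A : Set} (_≟_ : DecidableEquality A) where
  open import Data.List.Membership.DecPropositional _≟_ using (_∈?_)

  -- Colour the ground set by {true, false}: the events "P is all true and Q is all false"
  -- are pairwise exclusive and have probability at least 2^-d each.
  setPairs≤ : ∀ d (pairs : List (List A × List A)) →
    All (λ (P , Q) → ¬ Meets P Q) pairs →
    AllPairs (λ (P , Q) (P′ , Q′) → Meets P′ Q) pairs →
    All (λ (P , Q) → length P ℕ.+ length Q ℕ.≤ d) pairs →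
    length pairs ℕ.≤ 2 ^ d
  setPairs≤ d pairs disj cross small =
    subst (ℕ._≤ 2 ^ d) (length-map assign pairs)
      (subcubes≤ d ground (map assign pairs) (AllPairs.map⁺ (clashes id disj cross)) (All.map⁺ (All.map few small)))
    where
    assign : List A × List A → A → Maybe Bool
    assign (P , Q) x with x ∈? P | x ∈? Q
    ... | yes _ | _     = just true
    ... | no _  | yes _ = just false
    ... | no _  | no _  = nothing

    assign-P : ∀ {P Q x} → x ∈ P → assign (P , Q) x ≡ just true
    assign-P {P} {Q} {x} x∈P with x ∈? P
    ... | yes _   = refl
    ... | no x∉P = contradiction x∈P x∉P

    assign-Q : ∀ {P Q x} → ¬ Meets P Q → x ∈ Q → assign (P , Q) x ≡ just false
    assign-Q {P} {Q} {x} disj x∈Q with x ∈? P | x ∈? Q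
    ... | yes x∈P | _       = contradiction (x , x∈P , x∈Q) disj
    ... | no _    | yes _   = refl
    ... | no _    | no x∉Q = contradiction x∈Q x∉Q

    -- The first sets supply all coordinates at which clashes are found, since these are points of
    -- P′ ∩ Q. Without repetitions, the fixed coordinates of an assignment number at most |P| + |Q|.
    ground : List A
    ground = deduplicate _≟_ (concatMap proj₁ pairs)

    few : ∀ {pq} → length (proj₁ pq) ℕ.+ length (proj₂ pq) ℕ.≤ d → length (fixed (assign pq) ground) ℕ.≤ d
    few {P , Q} le = ℕ.≤-trans (length-mono-⊆ (Unique.filter⁺ (λ x → T? (is-just (assign (P , Q) x))) (DecUnique.deduplicate-! _≟_ (concatMap proj₁ pairs))) sub)
                               (ℕ.≤-trans (ℕ.≤-reflexive (length-++ P)) le)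
      where
      just⇒∈ : ∀ x → T (is-just (assign (P , Q) x)) → x ∈ P ++ Q
      just⇒∈ x t with x ∈? P | x ∈? Q
      ... | yes x∈P | _       = ∈-++⁺ˡ x∈P
      ... | no _    | yes x∈Q = ∈-++⁺ʳ P x∈Q
      sub : fixed (assign (P , Q)) ground ⊆ P ++ Q
      sub {x} x∈ = just⇒∈ x (proj₂ (∈-filter⁻ (λ x → T? (is-just (assign (P , Q) x))) {xs = ground} x∈))

    clashes : ∀ {qs} → qs ⊆ pairs → All (λ (P , Q) → ¬ Meets P Q) qs → AllPairs (λ (P , Q) (P′ , Q′) → Meets P′ Q) qs →
              AllPairs (λ c d → Clash ground (assign c) (assign d)) qs
    clashes sub []       []       = []
    clashes sub (p ∷ ps) (q ∷ qs) = All.tabulate clash ∷ clashes (sub ∘ there) ps qs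
      where
      clash : ∀ {r} → r ∈ _ → Clash ground _ (assign r)
      clash r∈ with All.lookup q r∈
      ... | x , x∈P′ , x∈Q = lose (∈-deduplicate⁺ _≟_ (∈-concatMap⁺ proj₁ (lose (sub (there r∈)) x∈P′)))
                                  (false , assign-Q p x∈Q , assign-P x∈P′)

-- Matchings and Gallai's exchange argument

Unique-resp-↭ : ∀ {A : Set} {xs ys : List A} → xs ↭ ys → Unique xs → Unique ys
Unique-resp-↭ _↭_.refl        xs!                       = xs!
Unique-resp-↭ (prep x p)      (x∉ ∷ xs!)                = ↭.All-resp-↭ p x∉ ∷ Unique-resp-↭ p xs!
Unique-resp-↭ (swap x y p)    ((x≢y ∷ x∉) ∷ y∉ ∷ xs!)  = (≢-sym x≢y ∷ ↭.All-resp-↭ p y∉) ∷ ↭.All-resp-↭ p x∉ ∷ Unique-resp-↭ p xs!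
Unique-resp-↭ (_↭_.trans p q) xs!                       = Unique-resp-↭ q (Unique-resp-↭ p xs!)

length-endpoints : ∀ {M} (es : List (Fin M × Fin M)) → length (endpoints es) ≡ 2 ℕ.* length es
length-endpoints []       = refl
length-endpoints (e ∷ es) = trans (cong (2 ℕ.+_) (length-endpoints es)) (sym (ℕ.*-suc 2 (length es)))

endpoints-resp-↭ : ∀ {M} {es fs : List (Fin M × Fin M)} → es ↭ fs → endpoints es ↭ endpoints fs
endpoints-resp-↭ _↭_.refl = ↭-refl
endpoints-resp-↭ (prep _ p) = prep _ (prep _ (endpoints-resp-↭ p))
endpoints-resp-↭ (swap (a , b) (c , d) p) =
  ↭-trans (↭.shifts (a ∷ b ∷ []) (c ∷ d ∷ [])) (prep c (prep d (prep a (prep b (endpoints-resp-↭ p)))))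
endpoints-resp-↭ (_↭_.trans p q) = ↭-trans (endpoints-resp-↭ p) (endpoints-resp-↭ q)

∈⇒↭ : ∀ {A : Set} {x : A} {xs} → x ∈ xs → ∃ λ ys → xs ↭ x ∷ ys
∈⇒↭ {x = x} x∈xs with ∈-∃++ x∈xs
... | as , bs , refl = as ++ bs , ↭.shift x as bs

∈-endpoints⁻ : ∀ {M} {x : Fin M} es → x ∈ endpoints es → ∃ λ y → (x , y) ∈ es ⊎ (y , x) ∈ es
∈-endpoints⁻ ((a , b) ∷ es) (here refl)         = b , inj₁ (here refl)
∈-endpoints⁻ ((a , b) ∷ es) (there (here refl)) = a , inj₂ (here refl)
∈-endpoints⁻ (_ ∷ es)       (there (there x∈)) with ∈-endpoints⁻ es x∈
... | y , inj₁ e∈ = y , inj₁ (there e∈)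
... | y , inj₂ e∈ = y , inj₂ (there e∈)

all-endpoints : ∀ {M} {F : Fin M → Fin M → Set} {P : Fin M → Set} → (∀ {a b} → F a b → P a × P b) →
                ∀ {es} → All (uncurry F) es → All P (endpoints es)
all-endpoints f []       = []
all-endpoints f (p ∷ ps) = proj₁ (f p) ∷ proj₂ (f p) ∷ all-endpoints f ps

-- Moves a matching to another graph when the edges survive thanks to a property of their ends, as
-- with deleted vertices.
restrict-edges : ∀ {M} {F G : Fin M → Fin M → Set} {P : Fin M → Set} → (∀ {a b} → F a b → P a → P b → G a b) →
                 ∀ {es} → All (uncurry F) es → All P (endpoints es) → All (uncurry G) es
restrict-edges f []       []           = []
restrict-edges f (e ∷ es) (a ∷ b ∷ ps) = f e a b ∷ restrict-edges f es ps

module _ {M : ℕ} where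

  private
    V : Set
    V = Fin M

  open import Data.List.Membership.DecPropositional (_≟ᶠ_ {M}) using (_∈?_)

  IsMatching : (V → V → Set) → List (V × V) → Set
  IsMatching F es = All (uncurry F) es × Unique (endpoints es)

  add-edge : ∀ {F : V → V → Set} {a b es} → F a b → a ≢ b → a ∉ endpoints es → b ∉ endpoints es →
             IsMatching F es → IsMatching F ((a , b) ∷ es)
  add-edge Fab a≢b a∉ b∉ (fs , es!) =
    Fab ∷ fs , (a≢b ∷ All.¬Any⇒All¬ _ a∉) ∷ All.¬Any⇒All¬ _ b∉ ∷ es!

  length≤M : ∀ {F es} → IsMatching F es → length es ℕ.≤ M
  length≤M {es = es} (_ , es!) = ℕ.≤-trans (ℕ.m≤n*m (length es) 2)
    (ℕ.≤-trans (ℕ.≤-reflexive (sym (length-endpoints es)))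
    (ℕ.≤-trans (length-mono-⊆ es! (λ {x} _ → ∈-allFin x)) (ℕ.≤-reflexive (length-tabulate id))))

  -- The permutation is recorded for endpoints instead of edges because `split-vertex` may have to
  -- reverse the edge that it extracts.
  record Split (F : V → V → Set) (es : List (V × V)) (e : V × V) : Set where
    constructor split
    field
      rest     : List (V × V)
      matching : IsMatching F (e ∷ rest)
      perm     : endpoints es ↭ endpoints (e ∷ rest)
      size     : length es ≡ suc (length rest)

  split-edge : ∀ {F es e} → IsMatching F es → e ∈ es → Split F es e
  split-edge (fs , es!) e∈ with ∈⇒↭ e∈
  ... | rest , p = split rest (↭.All-resp-↭ p fs , Unique-resp-↭ (endpoints-resp-↭ p) es!) (endpoints-resp-↭ p) (↭.↭-length p)

  split-vertex : ∀ {F es x} → Symmetric F → IsMatching F es → x ∈ endpoints es → ∃ λ y → Split F es (x , y)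
  split-vertex {es = es} Fsym m x∈ with ∈-endpoints⁻ es x∈
  ... | y , inj₁ e∈ = y , split-edge m e∈
  ... | y , inj₂ e∈ with split-edge m e∈
  ...   | split rest (f ∷ fs , es!) p sz =
            y , split rest (Fsym f ∷ fs , Unique-resp-↭ (swap _ _ ↭-refl) es!) (↭-trans p (swap _ _ ↭-refl)) sz

  -- If u — t — v, a maximum matching Ms misses u and v, and another one Ns misses t, then some
  -- x ≢ t is covered by Ms only.  Its Ms-edge xy can replace the Ns-edge at y, so deleting x and y
  -- lowers the matching number by one and keeps all hypotheses.
  gallai-exchange : ∀ s {F : V → V → Set} → Symmetric F → (∀ es → IsMatching F es → length es ℕ.≤ s) →
    ∀ {u t v} → F u t → F t v → u ≢ t → t ≢ v → u ≢ v →
    ∀ {Ms Ns} → IsMatching F Ms → length Ms ≡ s → u ∉ endpoints Ms → v ∉ endpoints Ms →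
    IsMatching F Ns → length Ns ≡ s → t ∉ endpoints Ns → ⊥
  -- The single edge ut already exceeds the matching number 0.
  gallai-exchange zero _ bound Fut _ u≢t _ _ _ _ _ _ _ _ _ =
    ℕ.n≮0 (bound _ (add-edge Fut u≢t (λ ()) (λ ()) ([] , [])))
  gallai-exchange s@(suc s′) {F} Fsym bound {u} {t} {v} Fut Ftv u≢t t≢v u≢v {Ms} {Ns} mM sM u∉M v∉M mN sN t∉N =
    finish (∃-∉ _≟ᶠ_ {u ∷ v ∷ endpoints Ms} {t ∷ endpoints Ns} uvM! count)
    where
    too-long : ∀ {a b es} → IsMatching F ((a , b) ∷ es) → length es ≢ s
    too-long m eq = ℕ.<-irrefl eq (bound _ m)

    u∈N : u ∈ endpoints Ns
    u∈N = decidable-stable (u ∈? endpoints Ns) λ u∉N → too-long (add-edge Fut u≢t u∉N t∉N mN) sN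

    v∈N : v ∈ endpoints Ns
    v∈N = decidable-stable (v ∈? endpoints Ns) λ v∉N → too-long (add-edge Ftv t≢v t∉N v∉N mN) sN

    uvM! : Unique (u ∷ v ∷ endpoints Ms)
    uvM! = (u≢v ∷ All.¬Any⇒All¬ _ u∉M) ∷ All.¬Any⇒All¬ _ v∉M ∷ proj₂ mM

    -- Here 2s + 1 vertices face 2s + 2, so some x is left over; it is neither u nor v, because `Ns`
    -- covers both.
    count : suc (length (endpoints Ns)) ℕ.< suc (suc (length (endpoints Ms)))
    count = ℕ.≤-reflexive (cong (2 ℕ.+_) (trans (length-endpoints Ns)
      (trans (cong (2 ℕ.*_) (trans sN (sym sM))) (sym (length-endpoints Ms)))))

    finish : (∃ λ x → x ∈ u ∷ v ∷ endpoints Ms × x ∉ t ∷ endpoints Ns) → ⊥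
    finish (x , here refl , x∉)         = x∉ (there u∈N)
    finish (x , there (here refl) , x∉) = x∉ (there v∈N)
    finish (x , there (there x∈M) , x∉) with split-vertex Fsym mM x∈M
    ... | y , split Ms′ (Fxy ∷ fM′ , (x≢y ∷ x∉M′) ∷ y∉M′ ∷ M′!) pM szM = finish′ (split-vertex Fsym mN y∈N)
      where
      x∉N : x ∉ endpoints Ns
      x∉N = x∉ ∘ there

      y∈N : y ∈ endpoints Ns
      y∈N = decidable-stable (y ∈? endpoints Ns) λ y∉N → too-long (add-edge Fxy x≢y x∉N y∉N mN) sN

      y∈M : y ∈ endpoints Ms
      y∈M = ↭.∈-resp-↭ (↭-sym pM) (there (here refl))

      Away : V → Set
      Away w = w ≢ x × w ≢ y

      F′ : V → V → Set
      F′ a b = F a b × Away a × Away b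

      F′sym : Symmetric F′
      F′sym (f , a , b) = Fsym f , b , a

      away-M : ∀ {w} → w ∉ endpoints Ms → Away w
      away-M w∉M = (λ { refl → w∉M x∈M }) , (λ { refl → w∉M y∈M })

      t-away : Away t
      t-away = (λ { refl → x∉ (here refl) }) , (λ { refl → t∉N y∈N })

      -- A matching that avoids x and y can be enlarged by the edge xy.
      bound′ : ∀ es → IsMatching F′ es → length es ℕ.≤ s′
      bound′ es (fs , es!) = ℕ.≤-pred (bound _ longer)
        where
        aways : All Away (endpoints es)
        aways = all-endpoints proj₂ fs
        longer : IsMatching F ((x , y) ∷ es)
        longer = add-edge Fxy x≢y (λ x∈ → proj₁ (All.lookup aways x∈) refl) (λ y∈ → proj₂ (All.lookup aways y∈) refl)
                          (All.map proj₁ fs , es!)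

      finish′ : (∃ λ z → Split F Ns (y , z)) → ⊥
      finish′ (z , split Ns′ (_ ∷ fN′ , (y≢z ∷ y∉N′) ∷ z∉N′ ∷ N′!) pN szN) =
        gallai-exchange s′ F′sym bound′
          (Fut , away-M u∉M , t-away) (Ftv , t-away , away-M v∉M) u≢t t≢v u≢v
          (restrict-edges (λ f a b → f , a , b) fM′ (All.tabulate (λ w∈ → ≢-sym (All.lookup x∉M′ w∈) , ≢-sym (All.lookup y∉M′ w∈))) , M′!)
          (ℕ.suc-injective (trans (sym szM) sM)) (u∉M ∘ M′⊆M) (v∉M ∘ M′⊆M)
          (restrict-edges (λ f a b → f , a , b) fN′ (All.tabulate (λ w∈ → (λ { refl → x∉N (N′⊆N w∈) }) , ≢-sym (All.lookup y∉N′ w∈))) , N′!)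
          (ℕ.suc-injective (trans (sym szN) sN)) (t∉N ∘ N′⊆N)
        where
        M′⊆M : endpoints Ms′ ⊆ endpoints Ms
        M′⊆M w∈ = ↭.∈-resp-↭ (↭-sym pM) (there (there w∈))
        N′⊆N : endpoints Ns′ ⊆ endpoints Ns
        N′⊆N w∈ = ↭.∈-resp-↭ (↭-sym pN) (there (there w∈))

-- Component labels and edge-saturated graphs

module _ {M : ℕ} where

  private
    V : Set
    V = Fin M

  allPairs : List (V × V)
  allPairs = cartesianProduct (allFin M) (allFin M)

  ∈-allPairs : ∀ u v → (u , v) ∈ allPairs
  ∈-allPairs u v = ∈-cartesianProduct⁺ (∈-allFin u) (∈-allFin v)

  record Labelling (R : V → V → Set) : Set where
    field
      label  : V → V
      edge⇒≡ : ∀ {u v} → R u v → label u ≡ label v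
      ≡⇒path : ∀ {u v} → label u ≡ label v → Star R u v

  -- Begins with the identity and goes through all pairs; a related pair (a, b) replaces the label
  -- of b everywhere by that of a. Two vertices whose labels become equal in this way are linked by
  -- a path through the edge ab.
  labelling : ∀ {R : V → V → Set} → Decidable₂ R → Symmetric R → Labelling R
  labelling {R} R? Rsym = record
    { label  = proj₁ labels
    ; edge⇒≡ = λ {u} {v} → All.lookup (proj₁ (proj₂ labels)) (∈-allPairs u v)
    ; ≡⇒path = λ {u} {v} → proj₂ (proj₂ labels) u v
    }
    where
    Labels : List (V × V) → Set
    Labels ps = Σ (V → V) λ c → All (λ (a , b) → R a b → c a ≡ c b) ps × (∀ u v → c u ≡ c v → Star R u v)

    build : ∀ ps → Labels ps
    build []             = id , [] , λ { u .u refl → Star.ε }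
    build ((a , b) ∷ ps) with build ps | R? a b
    ... | c , sound , path | no ¬Rab = c , (λ Rab → contradiction Rab ¬Rab) ∷ sound , path
    ... | c , sound , path | yes Rab = merge ∘ c , (λ _ → merged) ∷ All.map (cong merge ∘_) sound , path′
      where
      merge : V → V
      merge x with x ≟ᶠ c b
      ... | yes _ = c a
      ... | no _  = x

      merged : merge (c a) ≡ merge (c b)
      merged with c a ≟ᶠ c b | c b ≟ᶠ c b
      ... | yes _ | yes _ = refl
      ... | no _  | yes _ = refl
      ... | _     | no ¬p = contradiction refl ¬p

      path′ : ∀ u v → merge (c u) ≡ merge (c v) → Star R u v
      path′ u v eq with c u ≟ᶠ c b | c v ≟ᶠ c b
      ... | yes p | yes q = path u v (trans p (sym q))
      ... | yes p | no _  = path u b p ◅◅ Rsym Rab ◅ path a v eq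
      ... | no _  | yes q = path u a eq ◅◅ Rab ◅ path b v (sym q)
      ... | no _  | no _  = path u v eq

    labels : Labels allPairs
    labels = build allPairs

  -- Exhaustive search, by which the existence of a matching of a given size becomes decidable, so
  -- that the greedy saturation can branch on it.
  listOfLength? : ∀ s {P : List (V × V) → Set} → Decidable P → Dec (∃ λ es → length es ≡ s × P es)
  listOfLength? zero    P? = map′ (λ p → [] , refl , p) (λ { ([] , refl , p) → p }) (P? [])
  listOfLength? (suc s) P? = map′
    (λ { (u , v , es , eq , p) → (u , v) ∷ es , cong suc eq , p })
    (λ { ((u , v) ∷ es , eq , p) → u , v , es , ℕ.suc-injective eq , p })
    (Fin.any? λ u → Fin.any? λ v → listOfLength? s (λ es → P? ((u , v) ∷ es)))

-- One greedy pass is enough: by monotonicity a candidate that was rejected once would still be bad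
-- for the larger final list.
saturate : ∀ {A : Set} {Bad : List A → Set} → Decidable Bad → (∀ {xs ys} → xs ⊆ ys → Bad xs → Bad ys) →
  ∀ ps xs → ¬ Bad xs →
  ∃ λ ys → xs ⊆ ys × ys ⊆ xs ++ ps × ¬ Bad ys × (∀ {p} → p ∈ ps → p ∈ ys ⊎ Bad (p ∷ ys))
saturate Bad? mono []       xs good = xs , id , ∈-++⁺ˡ , good , λ ()
saturate Bad? mono (p ∷ ps) xs good with Bad? (p ∷ xs)
... | yes bad with saturate Bad? mono ps xs good
...   | ys , xs⊆ys , ys⊆ , good′ , sat = ys , xs⊆ys , ys⊆xspps , good′ , sat′
  where
  ys⊆xspps : ys ⊆ xs ++ p ∷ ps
  ys⊆xspps y∈ with ∈-++⁻ xs (ys⊆ y∈)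
  ... | inj₁ y∈xs = ∈-++⁺ˡ y∈xs
  ... | inj₂ y∈ps = ∈-++⁺ʳ xs (there y∈ps)
  sat′ : ∀ {q} → q ∈ p ∷ ps → q ∈ ys ⊎ _
  sat′ (here refl) = inj₂ (mono (λ { (here e) → here e ; (there z∈) → there (xs⊆ys z∈) }) bad)
  sat′ (there q∈)  = sat q∈
saturate Bad? mono (p ∷ ps) xs good | no ¬bad with saturate Bad? mono ps (p ∷ xs) ¬bad
...   | ys , pxs⊆ys , ys⊆ , good′ , sat = ys , pxs⊆ys ∘ there , ys⊆xspps , good′ , sat′
  where
  ys⊆xspps : ys ⊆ xs ++ p ∷ ps
  ys⊆xspps y∈ with ys⊆ y∈
  ... | here refl = ∈-++⁺ʳ xs (here refl)
  ... | there y∈′ with ∈-++⁻ xs y∈′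
  ...   | inj₁ y∈xs = ∈-++⁺ˡ y∈xs
  ...   | inj₂ y∈ps = ∈-++⁺ʳ xs (there y∈ps)
  sat′ : ∀ {q} → q ∈ p ∷ ps → q ∈ ys ⊎ _
  sat′ (here refl) = inj₁ (pxs⊆ys (here refl))
  sat′ (there q∈)  = sat q∈

InClass : ∀ {M} → (Fin M → Fin M) → Fin M → List (Fin M × Fin M) → Set
InClass c r es = All (λ v → c v ≡ r) (endpoints es)

-- Cuts any matching that is too large down to exactly s + 1 edges, the size that `Bad` looks for.
shrink : ∀ {M} {F : Fin M → Fin M → Set} {c r} m es → m ℕ.≤ length es → IsMatching F es → InClass c r es →
         ∃ λ es′ → length es′ ≡ m × IsMatching F es′ × InClass c r es′
shrink zero    _        _        _                                     _            = [] , refl , ([] , []) , []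
shrink (suc m) (_ ∷ es) (s≤s le) (f ∷ fs , (a≢b ∷ a∉) ∷ b∉ ∷ es!) (ca ∷ cb ∷ cs) with ℕ.m≤n⇒m<n∨m≡n le
... | inj₁ lt   = shrink (suc m) es lt (fs , es!) cs
... | inj₂ refl = _ ∷ es , refl , (f ∷ fs , (a≢b ∷ a∉) ∷ b∉ ∷ es!) , ca ∷ cb ∷ cs

-- Maximality is kept in the form of `missed`: together with `H-bound` it supplies the maximum
-- matchings that `gallai-exchange` compares.
record Saturated {M : ℕ} (c : Fin M → Fin M) (s : ℕ) (E : Fin M → Fin M → Set) : Set₁ where
  field
    H       : Fin M → Fin M → Set
    H?      : Decidable₂ H
    H-sym   : Symmetric H
    H⇒≢     : ∀ {u v} → H u v → u ≢ v
    H⇒c     : ∀ {u v} → H u v → c u ≡ c v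
    E⇒H     : ∀ {u v} → E u v → H u v
    H-bound : ∀ r es → IsMatching H es → InClass c r es → length es ℕ.≤ s
    missed  : ∀ {a b} → a ≢ b → c a ≡ c b → ¬ H a b →
      ∃ λ es → length es ≡ s × IsMatching H es × InClass c (c a) es × a ∉ endpoints es × b ∉ endpoints es

-- The graph obtained from E by adding as many edges inside the classes of c as possible
-- without creating a matching of size suc s in a class.
module Saturation
  {M : ℕ} (c : Fin M → Fin M) (s : ℕ)
  {E : Fin M → Fin M → Set} (E? : Decidable₂ E) (Esym : Symmetric E) (Eirr : ∀ {u} → ¬ E u u)
  (E⇒c : ∀ {u v} → E u v → c u ≡ c v)
  (Ebound : ∀ r es → IsMatching E es → InClass c r es → length es ℕ.≤ s)
  where

  private
    V : Set
    V = Fin M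

  open import Data.List.Membership.DecPropositional {A = V × V} (Product.≡-dec _≟ᶠ_ _≟ᶠ_) using (_∈?_)
  open import Data.List.Relation.Unary.Unique.DecPropositional (_≟ᶠ_ {M}) using (unique?)

  Adj : List (V × V) → V → V → Set
  Adj L a b = (a , b) ∈ L ⊎ (b , a) ∈ L

  Adj-sym : ∀ L → Symmetric (Adj L)
  Adj-sym L (inj₁ p) = inj₂ p
  Adj-sym L (inj₂ p) = inj₁ p

  Adj? : ∀ L → Decidable₂ (Adj L)
  Adj? L a b = ((a , b) ∈? L) ⊎-dec ((b , a) ∈? L)

  Inner : V × V → Set
  Inner (a , b) = a ≢ b × c a ≡ c b

  Inner? : Decidable Inner
  Inner? (a , b) = ¬? (a ≟ᶠ b) ×-dec (c a ≟ᶠ c b)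

  Bad : List (V × V) → Set
  Bad L = ∃ λ r → ∃ λ es → length es ≡ suc s × IsMatching (Adj L) es × InClass c r es

  Bad? : Decidable Bad
  Bad? L = Fin.any? λ r → listOfLength? (suc s) λ es →
    (All.all? (λ (a , b) → Adj? L a b) es ×-dec unique? (endpoints es)) ×-dec All.all? (λ v → c v ≟ᶠ r) (endpoints es)

  Bad-mono : ∀ {L L′} → L ⊆ L′ → Bad L → Bad L′
  Bad-mono sub (r , es , eq , (fs , es!) , cs) = r , es , eq , (All.map adj fs , es!) , cs
    where
    adj : ∀ {e} → uncurry (Adj _) e → uncurry (Adj _) e
    adj (inj₁ p) = inj₁ (sub p)
    adj (inj₂ p) = inj₂ (sub p)

  good⇒bound : ∀ L → ¬ Bad L → ∀ r es → IsMatching (Adj L) es → InClass c r es → length es ℕ.≤ s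
  good⇒bound L good r es m cs with length es ℕ.≤? s
  ... | yes le = le
  ... | no ¬le = contradiction (r , shrink (suc s) es (ℕ.≰⇒> ¬le) m cs) good

  Missed : List (V × V) → V → V → Set
  Missed L a b = ∃ λ es → length es ≡ s × IsMatching (Adj L) es × InClass c (c a) es × a ∉ endpoints es × b ∉ endpoints es

  -- A matching of size s + 1 that appears with the edge ab must contain ab, or `L` would be bad
  -- already. Without ab it has s edges and misses both a and b.
  bad-edge⇒missed : ∀ L a b → ¬ Bad L → Bad ((a , b) ∷ L) → Missed L a b
  bad-edge⇒missed L a b good (r , es , eq , (fs , es!) , cs) = pick (any? (λ (x , y) → ¬? (Adj? L x y)) es)
    where
    old : ∀ {x y} → Adj ((a , b) ∷ L) x y → x ≢ a → y ≢ a → Adj L x y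
    old (inj₁ (here refl)) x≢a y≢a = contradiction refl x≢a
    old (inj₁ (there p))   x≢a y≢a = inj₁ p
    old (inj₂ (here refl)) x≢a y≢a = contradiction refl y≢a
    old (inj₂ (there p))   x≢a y≢a = inj₂ p

    new : ∀ {x y} → Adj ((a , b) ∷ L) x y → ¬ Adj L x y → (x ≡ a × y ≡ b) ⊎ (x ≡ b × y ≡ a)
    new (inj₁ (here refl)) _  = inj₁ (refl , refl)
    new (inj₁ (there p))   ¬h = contradiction (inj₁ p) ¬h
    new (inj₂ (here refl)) _  = inj₂ (refl , refl)
    new (inj₂ (there p))   ¬h = contradiction (inj₂ p) ¬h

    remove : ∀ {x y} → Split (Adj ((a , b) ∷ L)) es (x , y) → (x ≡ a × y ≡ b) ⊎ (x ≡ b × y ≡ a) → Missed L a b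
    remove {x} {y} (split rest (_ ∷ gs , (_ ∷ x∉) ∷ y∉ ∷ rest!) perm sz) xy =
      rest , ℕ.suc-injective (trans (sym sz) eq)
      , (restrict-edges {P = _≢ a} old gs (All.¬Any⇒All¬ _ (proj₁ ends ∘ Any.map sym)) , rest!)
      , All.map (λ e → trans e (class xy)) cs-rest
      , ends
      where
      avoids : (x ≡ a × y ≡ b) ⊎ (x ≡ b × y ≡ a) → a ∉ endpoints rest × b ∉ endpoints rest
      avoids (inj₁ (refl , refl)) = All.All¬⇒¬Any x∉ , All.All¬⇒¬Any y∉
      avoids (inj₂ (refl , refl)) = All.All¬⇒¬Any y∉ , All.All¬⇒¬Any x∉
      ends = avoids xy
      cs′ = ↭.All-resp-↭ perm cs
      cs-rest : InClass c r rest
      cs-rest = All.tail (All.tail cs′)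
      class : (x ≡ a × y ≡ b) ⊎ (x ≡ b × y ≡ a) → r ≡ c a
      class (inj₁ (refl , _)) = sym (All.head cs′)
      class (inj₂ (_ , refl)) = sym (All.head (All.tail cs′))

    pick : Dec (Any (λ (x , y) → ¬ Adj L x y) es) → Missed L a b
    pick (yes some) with find some
    ... | (x , y) , e∈ , ¬h = remove (split-edge (fs , es!) e∈) (new (All.lookup fs e∈) ¬h)
    pick (no none) = contradiction
      (r , es , eq , (All.tabulate (λ {e} e∈ → decidable-stable (Adj? L (proj₁ e) (proj₂ e)) λ ¬h → none (lose e∈ ¬h)) , es!) , cs)
      good

  private
    start : List (V × V)
    start = filter (λ (a , b) → E? a b) allPairs

    start⇒E : ∀ {e} → e ∈ start → uncurry E e
    start⇒E e∈ = proj₂ (∈-filter⁻ (λ (a , b) → E? a b) {xs = allPairs} e∈)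

    ¬Bad-start : ¬ Bad start
    ¬Bad-start (r , es , eq , (fs , es!) , cs) =
      ℕ.<-irrefl eq (s≤s (Ebound r es (All.map adj fs , es!) cs))
      where
      adj : ∀ {e} → uncurry (Adj start) e → uncurry E e
      adj (inj₁ p) = start⇒E p
      adj (inj₂ p) = Esym (start⇒E p)

    saturated : ∃ λ ys → start ⊆ ys × ys ⊆ start ++ filter Inner? allPairs × ¬ Bad ys ×
                (∀ {p} → p ∈ filter Inner? allPairs → p ∈ ys ⊎ Bad (p ∷ ys))
    saturated = saturate Bad? Bad-mono (filter Inner? allPairs) start ¬Bad-start

    L : List (V × V)
    L = proj₁ saturated

    L-inner : ∀ {e} → e ∈ L → Inner e
    L-inner e∈ with ∈-++⁻ start (proj₁ (proj₂ (proj₂ saturated)) e∈)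
    ... | inj₁ p = (λ { refl → Eirr (start⇒E p) }) , E⇒c (start⇒E p)
    ... | inj₂ p = proj₂ (∈-filter⁻ Inner? {xs = allPairs} p)

    ¬Bad-L : ¬ Bad L
    ¬Bad-L = proj₁ (proj₂ (proj₂ (proj₂ saturated)))

    L-max : ∀ {e} → Inner e → e ∈ L ⊎ Bad (e ∷ L)
    L-max {a , b} i = proj₂ (proj₂ (proj₂ (proj₂ saturated))) (∈-filter⁺ Inner? (∈-allPairs a b) i)

  H : V → V → Set
  H = Adj L

  H? : Decidable₂ H
  H? = Adj? L

  H-sym : Symmetric H
  H-sym = Adj-sym L

  H⇒≢ : ∀ {u v} → H u v → u ≢ v
  H⇒≢ (inj₁ p) = proj₁ (L-inner p)
  H⇒≢ (inj₂ p) = ≢-sym (proj₁ (L-inner p))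

  H⇒c : ∀ {u v} → H u v → c u ≡ c v
  H⇒c (inj₁ p) = proj₂ (L-inner p)
  H⇒c (inj₂ p) = sym (proj₂ (L-inner p))

  E⇒H : ∀ {u v} → E u v → H u v
  E⇒H {u} {v} e = inj₁ (proj₁ (proj₂ saturated) (∈-filter⁺ (λ (a , b) → E? a b) (∈-allPairs u v) e))

  H-bound : ∀ r es → IsMatching H es → InClass c r es → length es ℕ.≤ s
  H-bound = good⇒bound L ¬Bad-L

  missed : ∀ {a b} → a ≢ b → c a ≡ c b → ¬ H a b → Missed L a b
  missed {a} {b} a≢b ca≡cb ¬Hab = Sum.[ (λ p → contradiction (inj₁ p) ¬Hab) , bad-edge⇒missed L a b ¬Bad-L ] (L-max (a≢b , ca≡cb))

  saturatedGraph : Saturated c s E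
  saturatedGraph = record
    { H = H ; H? = H? ; H-sym = H-sym ; H⇒≢ = H⇒≢ ; H⇒c = H⇒c ; E⇒H = E⇒H ; H-bound = H-bound ; missed = missed }

-- Gallai structure of saturated components: universal vertices and cliques

module Cliques {M : ℕ} {c : Fin M → Fin M} {s : ℕ} {E : Fin M → Fin M → Set} (S : Saturated c s E) where

  open Saturated S

  private
    V : Set
    V = Fin M

  Universal : V → Set
  Universal t = ∀ w → c w ≡ c t → w ≢ t → H t w

  Universal? : Decidable Universal
  Universal? t = Fin.all? λ w → (c w ≟ᶠ c t) →-dec (¬? (w ≟ᶠ t) →-dec H? t w)

  -- If uv were missing, a maximum matching of the class would miss u and v. As t is not universal,
  -- it has a non-neighbour in the class, so another maximum matching misses t; `gallai-exchange`
  -- excludes this.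
  H-trans : ∀ {u t v} → ¬ Universal t → u ≢ v → H u t → H t v → H u v
  H-trans {u} {t} {v} ¬Ut u≢v Hut Htv = decidable-stable (H? u v) λ ¬Huv →
    clash (missed u≢v (trans (H⇒c Hut) (H⇒c Htv)) ¬Huv) (Fin.¬∀⟶∃¬ M _ (λ w → (c w ≟ᶠ c t) →-dec (¬? (w ≟ᶠ t) →-dec H? t w)) ¬Ut)
    where
    -- Restricting `H` to the class of t turns the bound for one class into a bound on all matchings
    -- of the graph, as the exchange argument requires.
    F : V → V → Set
    F a b = H a b × c a ≡ c t

    Fsym : Symmetric F
    Fsym (h , e) = H-sym h , trans (sym (H⇒c h)) e

    F-bound : ∀ es → IsMatching F es → length es ℕ.≤ s
    F-bound es (fs , es!) = H-bound (c t) es (All.map proj₁ fs , es!)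
      (all-endpoints (λ f → proj₂ f , proj₂ (Fsym f)) fs)

    toF : ∀ {r es} → r ≡ c t → IsMatching H es → InClass c r es → IsMatching F es
    toF refl (fs , es!) cs = restrict-edges (λ h ca _ → h , ca) fs cs , es!

    clash : (∃ λ es → length es ≡ s × IsMatching H es × InClass c (c u) es × u ∉ endpoints es × v ∉ endpoints es) →
            (∃ λ w → ¬ (c w ≡ c t → w ≢ t → H t w)) → ⊥
    clash (Ms , sM , mM , cM , u∉ , v∉) (w , ¬imp) = with-w (missed {t} {w} t≢w ct≡cw (λ h → ¬imp λ _ _ → h))
      where
      ct≡cw : c t ≡ c w
      ct≡cw = sym (decidable-stable (c w ≟ᶠ c t) λ ne → ¬imp λ e → contradiction e ne)
      t≢w : t ≢ w
      t≢w e = ¬imp λ _ ne → contradiction (sym e) ne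
      with-w : _ → ⊥
      with-w (Ns , sN , mN , cN , t∉ , _) =
        gallai-exchange s Fsym F-bound (Hut , H⇒c Hut) (Htv , refl) (H⇒≢ Hut) (H⇒≢ Htv) u≢v
          (toF (H⇒c Hut) mM cM) sM u∉ v∉ (toF refl mN cN) sN t∉

  private
    R : V → V → Set
    R u v = H u v × ¬ Universal u × ¬ Universal v

    cliques : Labelling R
    cliques = labelling (λ u v → H? u v ×-dec (¬? (Universal? u) ×-dec ¬? (Universal? v)))
                        (λ { (h , u , v) → H-sym h , v , u })

    open Labelling cliques renaming (label to clique; edge⇒≡ to R⇒clique; ≡⇒path to clique⇒path)

    -- All vertices of a nonempty path are non-universal, so `H-trans` contracts it to one edge.
    -- Hence the components of `R` are cliques.
    path⇒R : ∀ {u v} → Star R u v → u ≡ v ⊎ R u v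
    path⇒R Star.ε = inj₁ refl
    path⇒R {u} {v} (r@(h , ¬u , ¬w) ◅ p) with path⇒R p
    ... | inj₁ refl = inj₂ r
    ... | inj₂ (h′ , _ , ¬v) with u ≟ᶠ v
    ...   | yes e = inj₁ e
    ...   | no ne = inj₂ (H-trans ¬w ne h h′ , ¬u , ¬v)

  -- Tags 0 and 1 name the class, tag 2 the clique.  Every in-list contains tag 0 and universal
  -- out-lists offer it; universal in-lists contain tag 1 and the other out-lists offer it.
  Mark : Set
  Mark = Fin 3 × V

  outMarks inMarks : V → List Mark
  outMarks u with Universal? u
  ... | yes _ = (0F , c u) ∷ []
  ... | no _  = (1F , c u) ∷ (2F , clique u) ∷ []
  inMarks v with Universal? v
  ... | yes _ = (0F , c v) ∷ (1F , c v) ∷ []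
  ... | no _  = (0F , c v) ∷ (2F , clique v) ∷ []

  outMarks≤2 : ∀ u → length (outMarks u) ℕ.≤ 2
  outMarks≤2 u with Universal? u
  ... | yes _ = s≤s z≤n
  ... | no _  = ℕ.≤-refl

  inMarks≤2 : ∀ u → length (inMarks u) ℕ.≤ 2
  inMarks≤2 u with Universal? u
  ... | yes _ = ℕ.≤-refl
  ... | no _  = ℕ.≤-refl

  H⇒meets : ∀ {u v} → H u v → Meets (outMarks u) (inMarks v)
  H⇒meets {u} {v} h with Universal? u | Universal? v
  ... | yes _ | yes _ = _ , here refl , here (cong (0F ,_) (H⇒c h))
  ... | yes _ | no _  = _ , here refl , here (cong (0F ,_) (H⇒c h))
  ... | no _  | yes _ = _ , here refl , there (here (cong (1F ,_) (H⇒c h)))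
  ... | no ¬u | no ¬v = _ , there (here refl) , there (here (cong (2F ,_) (R⇒clique (h , ¬u , ¬v))))

  -- A common mark with tag 0 makes u universal and one with tag 1 makes v universal, in a class
  -- containing both. Tag 2 can be shared only by two non-universal vertices, which then lie in one
  -- clique.
  meets⇒H : ∀ {u v} → u ≢ v → Meets (outMarks u) (inMarks v) → H u v
  meets⇒H {u} {v} u≢v m with Universal? u | Universal? v
  meets⇒H u≢v (_ , here refl , here e)                        | yes U | yes _ = U _ (sym (cong proj₂ e)) (≢-sym u≢v)
  meets⇒H u≢v (_ , here refl , there (here ()))               | yes U | yes _
  meets⇒H u≢v (_ , here refl , here e)                        | yes U | no _  = U _ (sym (cong proj₂ e)) (≢-sym u≢v)
  meets⇒H u≢v (_ , here refl , there (here ()))               | yes U | no _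
  meets⇒H u≢v (_ , here refl , there (here e))                | no _  | yes U = H-sym (U _ (cong proj₂ e) u≢v)
  meets⇒H u≢v (_ , here refl , here ())                       | no _  | yes U
  meets⇒H u≢v (_ , there (here refl) , here ())               | no _  | yes U
  meets⇒H u≢v (_ , there (here refl) , there (here ()))       | no _  | yes U
  meets⇒H u≢v (_ , here refl , here ())                       | no _  | no _
  meets⇒H u≢v (_ , here refl , there (here ()))               | no _  | no _
  meets⇒H u≢v (_ , there (here refl) , here ())               | no _  | no _
  meets⇒H u≢v (_ , there (here refl) , there (here e))        | no _  | no _ with path⇒R (clique⇒path (cong proj₂ e))
  ... | inj₁ u≡v     = contradiction u≡v u≢v
  ... | inj₂ (h , _) = h

-- List lemmas and colourings of complete graphs

length-concatMap≤ : ∀ {A B : Set} (f : A → List B) m → (∀ x → length (f x) ℕ.≤ m) →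
                    ∀ xs → length (concatMap f xs) ℕ.≤ length xs ℕ.* m
length-concatMap≤ f m f≤m []       = z≤n
length-concatMap≤ f m f≤m (x ∷ xs) =
  ℕ.≤-trans (ℕ.≤-reflexive (length-++ (f x))) (ℕ.+-mono-≤ (f≤m x) (length-concatMap≤ f m f≤m xs))

lookup-injective : ∀ {A : Set} {xs : List A} → Unique xs → ∀ i j → lookup xs i ≡ lookup xs j → i ≡ j
lookup-injective (_ ∷ _)     zero    zero    _  = refl
lookup-injective (x∉ ∷ _)    zero    (suc j) eq = contradiction eq (All.lookup x∉ (∈-lookup j))
lookup-injective (x∉ ∷ _)    (suc i) zero    eq = contradiction (sym eq) (All.lookup x∉ (∈-lookup i))
lookup-injective (_ ∷ xs!)   (suc i) (suc j) eq = cong suc (lookup-injective xs! i j eq)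

endpoints-map : ∀ {M N} (f : Fin N → Fin M) es → endpoints (map (Product.map f f) es) ≡ map f (endpoints es)
endpoints-map f []             = refl
endpoints-map f ((a , b) ∷ es) = cong (λ xs → f a ∷ f b ∷ xs) (endpoints-map f es)

module _ {k N : ℕ} (g : (i j : Fin N) → i Fin.< j → Fin k) where

  -- Only the orientation i < j is consulted, since colours chosen separately for (i, j) and (j, i)
  -- might differ.
  completeColouring : ColGraph k N
  completeColouring = record { col = colouring ; sym = colouring-sym ; irrefl = colouring-irrefl }
    where
    colouring : Fin N → Fin N → Maybe (Fin k)
    colouring i j with Fin.<-cmp i j
    ... | tri< i<j _ _ = just (g i j i<j)
    ... | tri≈ _ _ _   = nothing
    ... | tri> _ _ j<i = just (g j i j<i)

    colouring-sym : ∀ i j → colouring i j ≡ colouring j i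
    colouring-sym i j with Fin.<-cmp i j | Fin.<-cmp j i
    ... | tri< p _ _  | tri> _ _ q   = cong (just ∘ g i j) (ℕ.<-irrelevant p q)
    ... | tri> _ _ p  | tri< q _ _   = cong (just ∘ g j i) (ℕ.<-irrelevant p q)
    ... | tri≈ _ _ _  | tri≈ _ _ _   = refl
    ... | tri< p _ _  | tri< _ _ ¬q  = contradiction p ¬q
    ... | tri< _ ¬e _ | tri≈ _ e _   = contradiction (sym e) ¬e
    ... | tri≈ _ e _  | tri< _ ¬e _  = contradiction (sym e) ¬e
    ... | tri≈ _ e _  | tri> _ ¬e _  = contradiction (sym e) ¬e
    ... | tri> _ ¬e _ | tri≈ _ e _   = contradiction (sym e) ¬e
    ... | tri> _ _ p  | tri> ¬q _ _  = contradiction p ¬q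

    colouring-irrefl : ∀ i → colouring i i ≡ nothing
    colouring-irrefl i with Fin.<-cmp i i
    ... | tri< _ ¬e _ = contradiction refl ¬e
    ... | tri≈ _ _ _  = refl
    ... | tri> _ ¬e _ = contradiction refl ¬e

  completeColouring-view : ∀ i j → i ≢ j →
    (∃ λ i<j → col completeColouring i j ≡ just (g i j i<j)) ⊎ (∃ λ j<i → col completeColouring i j ≡ just (g j i j<i))
  completeColouring-view i j i≢j with Fin.<-cmp i j
  ... | tri< i<j _ _ = inj₁ (i<j , refl)
  ... | tri≈ _ e _   = contradiction e i≢j
  ... | tri> _ _ j<i = inj₂ (j<i , refl)

Extends : ∀ {k M N} → ColGraph k M → ColGraph k N → Set
Extends {M = M} {N} G G′ = Σ (Fin N → Fin M) λ f → Injective _≡_ _≡_ f ×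
  (∀ i j ℓ → col G (f i) (f j) ≡ just ℓ → col G′ i j ≡ just ℓ)

-- Deletion of vertices and completion of the colouring

module Completion {k M : ℕ} (G : ColGraph k M) (s D : ℕ)
  (G-bound : (m : MonoConnMatching G) → length (MonoConnMatching.edges m) ℕ.≤ s)
  (G-dense : ∀ u → length (nonNeighbours G u) ℕ.≤ D)
  where

  private
    V : Set
    V = Fin M

    E : Fin k → V → V → Set
    E ℓ u v = col G u v ≡ just ℓ

    E? : ∀ ℓ → Decidable₂ (E ℓ)
    E? ℓ u v = Maybe.≡-dec _≟ᶠ_ (col G u v) (just ℓ)

    E-sym : ∀ ℓ → Symmetric (E ℓ)
    E-sym ℓ {u} {v} e = trans (ColGraph.sym G v u) e

    E-irrefl : ∀ ℓ {u} → ¬ E ℓ u u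
    E-irrefl ℓ {u} e with trans (sym e) (ColGraph.irrefl G u)
    ... | ()

    abstract
      components : ∀ ℓ → Labelling (E ℓ)
      components ℓ = labelling (E? ℓ) (E-sym ℓ)

    c : Fin k → V → V
    c ℓ = Labelling.label (components ℓ)

    path⇒reach : ∀ {ℓ u v} → Star (E ℓ) u v → Reach G ℓ u v
    path⇒reach Star.ε  = Defs.here
    path⇒reach (e ◅ p) = Defs.step e (path⇒reach p)

    -- Equal labels give paths of colour ℓ from the first endpoint, so a matching inside one class
    -- is a monochromatic connected matching of `G`.
    E-bound : ∀ ℓ r es → IsMatching (E ℓ) es → InClass (c ℓ) r es → length es ℕ.≤ s
    E-bound ℓ r []                   _          _        = z≤n
    E-bound ℓ r es@((a , _) ∷ _) (fs , es!) cs = G-bound (record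
      { colour = ℓ ; edges = es ; coloured = fs ; disjoint = es! ; root = a
      ; connected = All.map (λ cv → path⇒reach (Labelling.≡⇒path (components ℓ) (trans (All.head cs) (sym cv)))) cs })

    abstract
      S : ∀ ℓ → Saturated (c ℓ) s (E ℓ)
      S ℓ = Saturation.saturatedGraph (c ℓ) s (E? ℓ) (E-sym ℓ) (E-irrefl ℓ) (Labelling.edge⇒≡ (components ℓ)) (E-bound ℓ)

    module S ℓ = Saturated (S ℓ)
    module C ℓ = Cliques (S ℓ)

    Joined : V → V → Set
    Joined u v = ∃ λ ℓ → S.H ℓ u v

    Joined? : Decidable₂ Joined
    Joined? u v = Fin.any? λ ℓ → S.H? ℓ u v

    Atom : Set
    Atom = Fin k × (Fin 3 × V)

    _≟ᵃ_ : DecidableEquality Atom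
    _≟ᵃ_ = Product.≡-dec _≟ᶠ_ (Product.≡-dec _≟ᶠ_ _≟ᶠ_)

    -- The colour is attached to each mark so that a common atom comes from a single colour.
    collect : (Fin k → List (Fin 3 × V)) → List Atom
    collect f = concatMap (λ ℓ → map (ℓ ,_) (f ℓ)) (allFin k)

    ∈-collect⁺ : ∀ f {ℓ x} → x ∈ f ℓ → (ℓ , x) ∈ collect f
    ∈-collect⁺ f {ℓ} x∈ = ∈-concatMap⁺ (λ ℓ → map (ℓ ,_) (f ℓ)) (lose (∈-allFin ℓ) (∈-map⁺ (ℓ ,_) x∈))

    ∈-collect⁻ : ∀ f {ℓ x} → (ℓ , x) ∈ collect f → x ∈ f ℓ
    ∈-collect⁻ f p with find (∈-concatMap⁻ (λ ℓ → map (ℓ ,_) (f ℓ)) {xs = allFin k} p)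
    ... | ℓ , _ , q with ∈-map⁻ (ℓ ,_) q
    ...   | x , x∈ , refl = x∈

    length-collect≤ : ∀ f → (∀ ℓ → length (f ℓ) ℕ.≤ 2) → length (collect f) ℕ.≤ k ℕ.* 2
    length-collect≤ f f≤2 = subst (λ m → length (collect f) ℕ.≤ m ℕ.* 2) (length-tabulate {n = k} id)
      (length-concatMap≤ _ 2 (λ ℓ → ℕ.≤-trans (ℕ.≤-reflexive (length-map (ℓ ,_) (f ℓ))) (f≤2 ℓ)) (allFin k))

    outAtoms inAtoms : V → List Atom
    outAtoms u = collect (λ ℓ → C.outMarks ℓ u)
    inAtoms  v = collect (λ ℓ → C.inMarks ℓ v)

    joined⇒meets : ∀ {u v} → Joined u v → Meets (outAtoms u) (inAtoms v)
    joined⇒meets {u} {v} (ℓ , h) with C.H⇒meets ℓ h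
    ... | x , x∈ , x∈′ = (ℓ , x) , ∈-collect⁺ (λ ℓ → C.outMarks ℓ u) x∈ , ∈-collect⁺ (λ ℓ → C.inMarks ℓ v) x∈′

    meets⇒joined : ∀ {u v} → u ≢ v → Meets (outAtoms u) (inAtoms v) → Joined u v
    meets⇒joined {u} {v} u≢v ((ℓ , x) , x∈ , x∈′) =
      ℓ , C.meets⇒H ℓ u≢v (x , ∈-collect⁻ (λ ℓ → C.outMarks ℓ u) x∈ , ∈-collect⁻ (λ ℓ → C.inMarks ℓ v) x∈′)

    Unjoined : V × V → Set
    Unjoined (u , v) = u ≢ v × ¬ Joined u v

    -- The list of pairs runs from the newest to the oldest: the vertex v of a newer pair survived
    -- the round of the older pair with first vertex u′.
    Crossing : V × V → V × V → Set
    Crossing (_ , v) (u′ , _) = Joined u′ v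

    -- Each of the k colours contributes at most two marks to either atom list, so the set-pair
    -- inequality applies with d = 4k.
    unjoined≤ : ∀ pairs → All Unjoined pairs → AllPairs Crossing pairs → length pairs ℕ.≤ 2 ^ (k ℕ.* 4)
    unjoined≤ pairs un cross = subst (ℕ._≤ 2 ^ (k ℕ.* 4)) (length-map atoms pairs)
      (setPairs≤ _≟ᵃ_ (k ℕ.* 4) (map atoms pairs)
        (All.map⁺ (All.map (λ { (u≢v , ¬j) m → ¬j (meets⇒joined u≢v m) }) un))
        (AllPairs.map⁺ (AllPairs.map joined⇒meets cross))
        (All.map⁺ (All.universal (λ { (u , v) → ℕ.≤-trans
          (ℕ.+-mono-≤ (length-collect≤ _ (λ ℓ → C.outMarks≤2 ℓ u)) (length-collect≤ _ (λ ℓ → C.inMarks≤2 ℓ v)))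
          (ℕ.≤-reflexive (sym (ℕ.*-distribˡ-+ k 2 2))) }) pairs)))
      where
      atoms : V × V → List Atom × List Atom
      atoms (u , v) = outAtoms u , inAtoms v

    col⇒joined : ∀ {u v} → col G u v ≢ nothing → Joined u v
    col⇒joined {u} {v} ne with col G u v in eq
    ... | just ℓ  = ℓ , S.E⇒H ℓ eq
    ... | nothing = contradiction refl ne

    NN? : ∀ u → Decidable (λ v → v ≢ u × col G u v ≡ nothing)
    NN? u v = ¬? (v ≟ᶠ u) ×-dec Maybe.≡-dec _≟ᶠ_ (col G u v) nothing

    unjoined⇒∈NN : ∀ {u v} → v ≢ u → ¬ Joined u v → v ∈ nonNeighbours G u
    unjoined⇒∈NN {u} {v} v≢u ¬j = ∈-filter⁺ (NN? u) (∈-allFin v)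
      (v≢u , decidable-stable (Maybe.≡-dec _≟ᶠ_ (col G u v) nothing) λ ne → ¬j (col⇒joined ne))

    ∉NN⇒joined : ∀ {u v} → v ≢ u → v ∉ nonNeighbours G u → Joined u v
    ∉NN⇒joined {u} {v} v≢u v∉ = decidable-stable (Joined? u v) λ ¬j → v∉ (unjoined⇒∈NN v≢u ¬j)

    PairwiseJoined : List V → Set
    PairwiseJoined R = ∀ {u v} → u ∈ R → v ∈ R → u ≢ v → Joined u v

    -- `fuel` is the number of rounds still permitted by `unjoined≤`, and each round costs at most
    -- 2D vertices. The survivors stay joined to the first vertices of all earlier pairs, which
    -- yields `Crossing` for the next pair.
    clean : ∀ fuel pairs R → length pairs ℕ.+ fuel ≡ 2 ^ (k ℕ.* 4) →
      All Unjoined pairs → AllPairs Crossing pairs → (∀ {w} → w ∈ R → All (λ (u , _) → Joined u w) pairs) → Unique R →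
      ∃ λ R′ → Unique R′ × PairwiseJoined R′ × length R ℕ.≤ length R′ ℕ.+ fuel ℕ.* (2 ℕ.* D)
    clean fuel pairs R budget un cross touch R! with any? (λ u → any? (λ v → ¬? (u ≟ᶠ v) ×-dec ¬? (Joined? u v)) R) R
    ... | no none = R , R! , joined , ℕ.m≤m+n (length R) _
      where
      joined : PairwiseJoined R
      joined {u} {v} u∈ v∈ u≢v = decidable-stable (Joined? u v) λ ¬j → none (lose u∈ (lose v∈ (u≢v , ¬j)))
    ... | yes some with find some
    ...   | u , u∈ , some′ with find some′
    ...     | v , v∈ , u≢v , ¬j = continue fuel budget
      where
      pairs′ : List (V × V)
      pairs′ = (u , v) ∷ pairs

      un′ : All Unjoined pairs′
      un′ = (u≢v , ¬j) ∷ un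

      cross′ : AllPairs Crossing pairs′
      cross′ = touch v∈ ∷ cross

      removed : List V
      removed = nonNeighbours G u ++ nonNeighbours G v

      open import Data.List.Membership.DecPropositional (_≟ᶠ_ {M}) using (_∈?_)

      kept? : Decidable (_∉ removed)
      kept? w = ¬? (w ∈? removed)

      R″ : List V
      R″ = filter kept? R

      touch′ : ∀ {w} → w ∈ R″ → All (λ (x , _) → Joined x w) pairs′
      touch′ {w} w∈ with ∈-filter⁻ kept? {xs = R} w∈
      ... | w∈R , w∉ = ∉NN⇒joined w≢u (w∉ ∘ ∈-++⁺ˡ) ∷ touch w∈R
        where
        -- The list `nonNeighbours G u` omits u itself, but u is a non-neighbour of v and is removed
        -- on that account.
        w≢u : w ≢ u
        w≢u refl = w∉ (∈-++⁺ʳ (nonNeighbours G u)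
          (unjoined⇒∈NN u≢v λ { (ℓ , h) → ¬j (ℓ , S.H-sym ℓ h) }))

      R⊆ : R ⊆ R″ ++ removed
      R⊆ {w} w∈ with w ∈? removed
      ... | yes w∈rem = ∈-++⁺ʳ R″ w∈rem
      ... | no w∉rem  = ∈-++⁺ˡ (∈-filter⁺ kept? w∈ w∉rem)

      removed≤ : length removed ℕ.≤ 2 ℕ.* D
      removed≤ = begin
        length removed                                                ≡⟨ length-++ (nonNeighbours G u) ⟩
        length (nonNeighbours G u) ℕ.+ length (nonNeighbours G v)     ≤⟨ ℕ.+-mono-≤ (G-dense u) (G-dense v) ⟩
        D ℕ.+ D                                                       ≡⟨ cong (D ℕ.+_) (ℕ.+-identityʳ D) ⟨
        2 ℕ.* D                                                       ∎
        where open ℕ.≤-Reasoning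

      continue : ∀ fuel → length pairs ℕ.+ fuel ≡ 2 ^ (k ℕ.* 4) →
        ∃ λ R′ → Unique R′ × PairwiseJoined R′ × length R ℕ.≤ length R′ ℕ.+ fuel ℕ.* (2 ℕ.* D)
      -- With the budget spent, the new pair would be number 2^(4k) + 1.
      continue zero    budget = contradiction (unjoined≤ pairs′ un′ cross′)
        (ℕ.<⇒≱ (s≤s (ℕ.≤-reflexive (trans (sym budget) (ℕ.+-identityʳ _)))))
      continue (suc fuel) budget with clean fuel pairs′ R″ (trans (sym (ℕ.+-suc _ fuel)) budget) un′ cross′ touch′ (Unique.filter⁺ kept? R!)
      ... | R′ , R′! , joined , le = R′ , R′! , joined , (begin
        length R                                            ≤⟨ length-mono-⊆ R! R⊆ ⟩
        length (R″ ++ removed)                              ≡⟨ length-++ R″ ⟩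
        length R″ ℕ.+ length removed                        ≤⟨ ℕ.+-mono-≤ le removed≤ ⟩
        length R′ ℕ.+ fuel ℕ.* (2 ℕ.* D) ℕ.+ 2 ℕ.* D        ≡⟨ ℕ.+-assoc (length R′) _ _ ⟩
        length R′ ℕ.+ (fuel ℕ.* (2 ℕ.* D) ℕ.+ 2 ℕ.* D)      ≡⟨ cong (length R′ ℕ.+_) (ℕ.+-comm (fuel ℕ.* (2 ℕ.* D)) (2 ℕ.* D)) ⟩
        length R′ ℕ.+ suc fuel ℕ.* (2 ℕ.* D)                ∎)
        where open ℕ.≤-Reasoning

    -- An edge of `G` keeps its own colour; a missing edge takes the colour in which saturation
    -- joined its ends.
    choose : ∀ {u v} → Joined u v → ∃ λ ℓ → S.H ℓ u v × (∀ ℓ′ → col G u v ≡ just ℓ′ → ℓ ≡ ℓ′)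
    choose {u} {v} (ℓ , h) with col G u v in eq
    ... | just ℓ₀ = ℓ₀ , S.E⇒H ℓ₀ eq , λ { ℓ′ refl → refl }
    ... | nothing = ℓ , h , λ ℓ′ ()

  completion : ∀ N → N ℕ.+ 2 ^ (k ℕ.* 4) ℕ.* (2 ℕ.* D) ℕ.≤ M →
    Σ (ColGraph k N) λ G′ → Complete G′ × ((m : MonoConnMatching G′) → length (MonoConnMatching.edges m) ℕ.≤ s) × Extends G G′
  completion N N≤ with clean (2 ^ (k ℕ.* 4)) [] (allFin M) refl [] [] (λ _ → []) (Unique.allFin⁺ M)
  ... | R , R! , joined , M≤ = G′ , complete , bound , f , f-inj , preserves
    where
    N≤R : N ℕ.≤ length R
    N≤R = ℕ.+-cancelʳ-≤ _ N (length R) (ℕ.≤-trans N≤ (ℕ.≤-trans (ℕ.≤-reflexive (sym (length-tabulate id))) M≤))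

    f : Fin N → V
    f i = lookup R (Fin.inject≤ i N≤R)

    f-inj : Injective _≡_ _≡_ f
    f-inj eq = Fin.inject≤-injective N≤R N≤R _ _ (lookup-injective R! _ _ eq)

    chosen : ∀ i j → i ≢ j → ∃ λ ℓ → S.H ℓ (f i) (f j) × (∀ ℓ′ → col G (f i) (f j) ≡ just ℓ′ → ℓ ≡ ℓ′)
    chosen i j i≢j = choose (joined (∈-lookup _) (∈-lookup _) (i≢j ∘ f-inj))

    g : (i j : Fin N) → i Fin.< j → Fin k
    g i j i<j = proj₁ (chosen i j (Fin.<⇒≢ i<j))

    G′ : ColGraph k N
    G′ = completeColouring g

    G′-spec : ∀ i j → i ≢ j → ∃ λ ℓ → col G′ i j ≡ just ℓ × S.H ℓ (f i) (f j) × (∀ ℓ′ → col G (f i) (f j) ≡ just ℓ′ → ℓ ≡ ℓ′)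
    G′-spec i j i≢j with completeColouring-view g i j i≢j
    ... | inj₁ (i<j , eq) = _ , eq , proj₂ (chosen i j (Fin.<⇒≢ i<j))
    ... | inj₂ (j<i , eq) with chosen j i (Fin.<⇒≢ j<i)
    ...   | ℓ , h , same = ℓ , eq , S.H-sym ℓ h , λ ℓ′ e → same ℓ′ (trans (ColGraph.sym G (f j) (f i)) e)

    distinct : ∀ {i j ℓ} → col G′ i j ≡ just ℓ → i ≢ j
    distinct {i} e refl with trans (sym e) (ColGraph.irrefl G′ i)
    ... | ()

    complete : Complete G′
    complete i j i≢j e with G′-spec i j i≢j
    ... | ℓ , e′ , _ with trans (sym e) e′
    ...   | ()

    preserves : ∀ i j ℓ → col G (f i) (f j) ≡ just ℓ → col G′ i j ≡ just ℓ
    preserves i j ℓ e with i ≟ᶠ j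
    ... | yes refl = contradiction e (E-irrefl ℓ)
    ... | no i≢j with G′-spec i j i≢j
    ...   | ℓ₀ , e′ , _ , same = trans e′ (cong just (same ℓ e))

    G′⇒H : ∀ {i j ℓ} → col G′ i j ≡ just ℓ → S.H ℓ (f i) (f j)
    G′⇒H {i} {j} e with G′-spec i j (distinct e)
    ... | ℓ₀ , e′ , h , _ with trans (sym e) e′
    ...   | refl = h

    -- Edges of the saturated graphs never leave a class, so the components of `G′` do not merge
    -- different components of `G`.
    reach⇒class : ∀ {ℓ i j} → Reach G′ ℓ i j → c ℓ (f i) ≡ c ℓ (f j)
    reach⇒class     Defs.here       = refl
    reach⇒class {ℓ} (Defs.step e p) = trans (S.H⇒c ℓ (G′⇒H e)) (reach⇒class p)

    -- Mapped by `f`, the matching lies in one class of the saturated graph of its colour, where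
    -- `H-bound` limits it.
    bound : (m : MonoConnMatching G′) → length (MonoConnMatching.edges m) ℕ.≤ s
    bound m = subst (ℕ._≤ s) (length-map (Product.map f f) edges)
      (S.H-bound colour (c colour (f root)) (map (Product.map f f) edges)
        (All.map⁺ (All.map G′⇒H coloured) , subst Unique (sym (endpoints-map f edges)) (Unique.map⁺ f-inj disjoint))
        (subst (All (λ v → c colour v ≡ c colour (f root))) (sym (endpoints-map f edges))
          (All.map⁺ (All.map (λ r → sym (reach⇒class r)) connected))))
      where open MonoConnMatching m

-- Integer thresholds and rational estimates

largest : ∀ {P : ℕ → Set} → Decidable P → P 0 → ∀ m → ∃ λ s → P s × (∀ j → j ℕ.≤ m → P j → j ℕ.≤ s)
largest P? P0 zero    = 0 , P0 , λ j j≤0 _ → j≤0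
largest P? P0 (suc m) with P? (suc m)
... | yes p = suc m , p , λ j j≤ _ → j≤
... | no ¬p with largest P? P0 m
...   | s , Ps , max = s , Ps , λ j j≤ Pj → max j (ℕ.≤-pred (ℕ.≤∧≢⇒< j≤ λ { refl → ¬p Pj })) Pj

toℚᵘ-⟦⟧ : ∀ a → ℚ.toℚᵘ ⟦ a ⟧ ℚᵘ.≃ ℚᵘ.mkℚᵘ (+ a) 0
toℚᵘ-⟦⟧ a = ℚ.toℚᵘ-fromℚᵘ (ℚᵘ.mkℚᵘ (+ a) 0)

⟦⟧-+ : ∀ a b → ⟦ a ℕ.+ b ⟧ ≡ ⟦ a ⟧ + ⟦ b ⟧
⟦⟧-+ a b = ℚ.toℚᵘ-injective (begin-equality
  ℚ.toℚᵘ ⟦ a ℕ.+ b ⟧                        ≃⟨ toℚᵘ-⟦⟧ (a ℕ.+ b) ⟩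
  ℚᵘ.mkℚᵘ (+ (a ℕ.+ b)) 0                   ≃⟨ ℚᵘ.*≡* (cong (ℤ._* + 1) (sym (cong₂ ℤ._+_ (ℤ.*-identityʳ (+ a)) (ℤ.*-identityʳ (+ b))))) ⟩
  ℚᵘ.mkℚᵘ (+ a) 0 ℚᵘ.+ ℚᵘ.mkℚᵘ (+ b) 0      ≃⟨ ℚᵘ.+-cong (toℚᵘ-⟦⟧ a) (toℚᵘ-⟦⟧ b) ⟨
  ℚ.toℚᵘ ⟦ a ⟧ ℚᵘ.+ ℚ.toℚᵘ ⟦ b ⟧            ≃⟨ ℚ.toℚᵘ-homo-+ ⟦ a ⟧ ⟦ b ⟧ ⟨
  ℚ.toℚᵘ (⟦ a ⟧ + ⟦ b ⟧)                    ∎)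
  where open ℚᵘ.≤-Reasoning

⟦⟧-* : ∀ a b → ⟦ a ℕ.* b ⟧ ≡ ⟦ a ⟧ * ⟦ b ⟧
⟦⟧-* a b = ℚ.toℚᵘ-injective (begin-equality
  ℚ.toℚᵘ ⟦ a ℕ.* b ⟧                        ≃⟨ toℚᵘ-⟦⟧ (a ℕ.* b) ⟩
  ℚᵘ.mkℚᵘ (+ (a ℕ.* b)) 0                   ≃⟨ ℚᵘ.*≡* (cong (ℤ._* + 1) (ℤ.pos-* a b)) ⟩
  ℚᵘ.mkℚᵘ (+ a) 0 ℚᵘ.* ℚᵘ.mkℚᵘ (+ b) 0      ≃⟨ ℚᵘ.*-cong (toℚᵘ-⟦⟧ a) (toℚᵘ-⟦⟧ b) ⟨
  ℚ.toℚᵘ ⟦ a ⟧ ℚᵘ.* ℚ.toℚᵘ ⟦ b ⟧            ≃⟨ ℚ.toℚᵘ-homo-* ⟦ a ⟧ ⟦ b ⟧ ⟨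
  ℚ.toℚᵘ (⟦ a ⟧ * ⟦ b ⟧)                    ∎)
  where open ℚᵘ.≤-Reasoning

⟦⟧-mono-≤ : ∀ {a b} → a ℕ.≤ b → ⟦ a ⟧ ≤ ⟦ b ⟧
⟦⟧-mono-≤ {a} {b} a≤b = ℚ.toℚᵘ-cancel-≤ (begin
  ℚ.toℚᵘ ⟦ a ⟧      ≃⟨ toℚᵘ-⟦⟧ a ⟩
  ℚᵘ.mkℚᵘ (+ a) 0   ≤⟨ ℚᵘ.*≤* (ℤ.*-monoʳ-≤-nonNeg (+ 1) (ℤ.+≤+ a≤b)) ⟩
  ℚᵘ.mkℚᵘ (+ b) 0   ≃⟨ toℚᵘ-⟦⟧ b ⟨
  ℚ.toℚᵘ ⟦ b ⟧      ∎)
  where open ℚᵘ.≤-Reasoning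

⟦⟧-cancel-≤ : ∀ {a b} → ⟦ a ⟧ ≤ ⟦ b ⟧ → a ℕ.≤ b
⟦⟧-cancel-≤ {a} {b} le = cancel (begin
  ℚᵘ.mkℚᵘ (+ a) 0   ≃⟨ toℚᵘ-⟦⟧ a ⟨
  ℚ.toℚᵘ ⟦ a ⟧      ≤⟨ ℚ.toℚᵘ-mono-≤ le ⟩
  ℚ.toℚᵘ ⟦ b ⟧      ≃⟨ toℚᵘ-⟦⟧ b ⟩
  ℚᵘ.mkℚᵘ (+ b) 0   ∎)
  where
  open ℚᵘ.≤-Reasoning
  cancel : ℚᵘ.mkℚᵘ (+ a) 0 ℚᵘ.≤ ℚᵘ.mkℚᵘ (+ b) 0 → a ℕ.≤ b
  cancel (ℚᵘ.*≤* p) = ℤ.drop‿+≤+ (ℤ.*-cancelʳ-≤-pos (+ a) (+ b) (+ 1) p)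

*-nonNeg : ∀ {p q} → 0ℚ ≤ p → 0ℚ ≤ q → 0ℚ ≤ p * q
*-nonNeg {p} {q} 0≤p 0≤q =
  ℚ.nonNegative⁻¹ (p * q) {{ℚ.nonNeg*nonNeg⇒nonNeg p {{ℚ.nonNegative 0≤p}} q {{ℚ.nonNegative 0≤q}}}}

*-monoʳ : ∀ {p q} r → 0ℚ ≤ r → p ≤ q → p * r ≤ q * r
*-monoʳ r 0≤r = ℚ.*-monoʳ-≤-nonNeg r {{ℚ.nonNegative 0≤r}}

*-monoˡ : ∀ {p q} r → 0ℚ ≤ r → p ≤ q → r * p ≤ r * q
*-monoˡ r 0≤r = ℚ.*-monoˡ-≤-nonNeg r {{ℚ.nonNegative 0≤r}}

⟦⟧-nonNeg : ∀ a → 0ℚ ≤ ⟦ a ⟧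
⟦⟧-nonNeg a = ⟦⟧-mono-≤ {0} {a} z≤n

module _ {x : ℚ} (0≤x : 0ℚ ≤ x) where

  ^-nonNeg : ∀ m → 0ℚ ≤ x Defs.^ m
  ^-nonNeg zero    = ⟦⟧-nonNeg 1
  ^-nonNeg (suc m) = *-nonNeg 0≤x (^-nonNeg m)

  -- The left side is the m-th power of `⟦ b ⟧ * x`.
  scaled-^≤1 : ∀ b → ⟦ b ⟧ * x ≤ 1ℚ → ∀ m → ⟦ b ^ m ⟧ * (x Defs.^ m) ≤ 1ℚ
  scaled-^≤1 b bx≤1 zero    = ℚ.≤-refl
  scaled-^≤1 b bx≤1 (suc m) = begin
    ⟦ b ℕ.* b ^ m ⟧ * (x * (x Defs.^ m))      ≡⟨ cong (_* (x * (x Defs.^ m))) (⟦⟧-* b (b ^ m)) ⟩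
    ⟦ b ⟧ * ⟦ b ^ m ⟧ * (x * (x Defs.^ m))    ≡⟨ solve 4 (λ b c x y → b :* c :* (x :* y) := b :* x :* (c :* y)) refl ⟦ b ⟧ ⟦ b ^ m ⟧ x (x Defs.^ m) ⟩
    ⟦ b ⟧ * x * (⟦ b ^ m ⟧ * (x Defs.^ m))    ≤⟨ *-monoʳ _ (*-nonNeg (⟦⟧-nonNeg (b ^ m)) (^-nonNeg m)) bx≤1 ⟩
    1ℚ * (⟦ b ^ m ⟧ * (x Defs.^ m))           ≡⟨ ℚ.*-identityˡ _ ⟩
    ⟦ b ^ m ⟧ * (x Defs.^ m)                  ≤⟨ scaled-^≤1 b bx≤1 m ⟩
    1ℚ                                        ∎
    where
    open ℚ.≤-Reasoning
    open ℚSolver.+-*-Solver using (solve; _:*_; _:=_)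

-- Takes x = α/(16β), for which 16x = α/β ≤ 1, and so hides the division from the later estimates.
delta-form : ∀ k α β ε → 0ℚ < α → α ≤ β → (β>0 : 0ℚ < β) →
  ∃ λ x → 0ℚ ≤ x × ⟦ 16 ⟧ * x ≤ 1ℚ × delta k α β ε β>0 ≡ (ε * ℚ.½) * (x Defs.^ (2 ℕ.* k))
delta-form k α β ε 0<α α≤β β>0 = _ , *-nonNeg (ℚ.<⇒≤ 0<α) 0≤inv , 16x≤1 , refl
  where
  q : ℚ
  q = ⟦ 16 ⟧ * β
  instance
    q-pos : ℚ.Positive q
    q-pos = ℚ.pos*pos⇒pos ⟦ 16 ⟧ β {{ℚ.positive β>0}}
    q-nonZero : ℚ.NonZero q
    q-nonZero = ℚ.pos⇒nonZero q
  0≤inv : 0ℚ ≤ ℚ.1/ q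
  0≤inv = ℚ.<⇒≤ (ℚ.positive⁻¹ (ℚ.1/ q) {{ℚ.1/pos⇒pos q}})
  open ℚ.≤-Reasoning
  16x≤1 : ⟦ 16 ⟧ * (α * ℚ.1/ q) ≤ 1ℚ
  16x≤1 = begin
    ⟦ 16 ⟧ * (α * ℚ.1/ q)   ≤⟨ *-monoˡ ⟦ 16 ⟧ (⟦⟧-nonNeg 16) (*-monoʳ (ℚ.1/ q) 0≤inv α≤β) ⟩
    ⟦ 16 ⟧ * (β * ℚ.1/ q)   ≡⟨ ℚ.*-assoc ⟦ 16 ⟧ β (ℚ.1/ q) ⟨
    q * ℚ.1/ q              ≡⟨ ℚ.*-inverseʳ q ⟩
    1ℚ                      ∎

-- Compares the number of deletion rounds with the power of 16 in the denominator of δ.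
2^4k≤16^2k : ∀ k → 2 ^ (k ℕ.* 4) ℕ.≤ 16 ^ (2 ℕ.* k)
2^4k≤16^2k k = begin
  2 ^ (k ℕ.* 4)   ≡⟨ cong (2 ^_) (ℕ.*-comm k 4) ⟩
  2 ^ (4 ℕ.* k)   ≡⟨ ℕ.^-*-assoc 2 4 k ⟨
  16 ^ k          ≤⟨ ℕ.^-monoʳ-≤ 16 (ℕ.m≤n*m k 2) ⟩
  16 ^ (2 ℕ.* k)  ∎
  where open ℕ.≤-Reasoning

-- Twice δ is ε x^(2k), and the number of rounds times x^(2k) is at most (16x)^(2k) ≤ 1.
deletions≤ : ∀ k ε n D δ x → 0ℚ ≤ x → ⟦ 16 ⟧ * x ≤ 1ℚ → δ ≡ (ε * ℚ.½) * (x Defs.^ (2 ℕ.* k)) → 0ℚ ≤ ε → 0ℚ ≤ n →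
  ⟦ D ⟧ ≤ δ * n → ⟦ 2 ^ (k ℕ.* 4) ℕ.* (2 ℕ.* D) ⟧ ≤ ε * n
deletions≤ k ε n D δ x 0≤x 16x≤1 eq 0≤ε 0≤n D≤ = begin
  ⟦ A ℕ.* (2 ℕ.* D) ⟧                    ≡⟨ trans (⟦⟧-* A (2 ℕ.* D)) (cong (⟦ A ⟧ *_) (⟦⟧-* 2 D)) ⟩
  ⟦ A ⟧ * (⟦ 2 ⟧ * ⟦ D ⟧)                ≤⟨ *-monoˡ ⟦ A ⟧ (⟦⟧-nonNeg A) (*-monoˡ ⟦ 2 ⟧ (⟦⟧-nonNeg 2) D≤) ⟩
  ⟦ A ⟧ * (⟦ 2 ⟧ * (δ * n))              ≡⟨ cong (λ d → ⟦ A ⟧ * (⟦ 2 ⟧ * (d * n))) eq ⟩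
  -- The product `⟦ 2 ⟧ * ℚ.½` split off by `regroup` evaluates to `1ℚ`.
  ⟦ A ⟧ * (⟦ 2 ⟧ * ((ε * ℚ.½) * y * n))  ≡⟨ regroup ⟦ A ⟧ ⟦ 2 ⟧ ε ℚ.½ y n ⟩
  1ℚ * ((⟦ A ⟧ * y) * (ε * n))           ≡⟨ ℚ.*-identityˡ _ ⟩
  (⟦ A ⟧ * y) * (ε * n)                  ≤⟨ *-monoʳ (ε * n) (*-nonNeg 0≤ε 0≤n) Ay≤1 ⟩
  1ℚ * (ε * n)                           ≡⟨ ℚ.*-identityˡ _ ⟩
  ε * n                                  ∎
  where
  open ℚ.≤-Reasoning
  open ℚSolver.+-*-Solver using (solve; _:*_; _:=_)
  A : ℕ
  A = 2 ^ (k ℕ.* 4)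
  y : ℚ
  y = x Defs.^ (2 ℕ.* k)
  regroup : ∀ a t e h y n → a * (t * ((e * h) * y * n)) ≡ (t * h) * ((a * y) * (e * n))
  regroup = solve 6 (λ a t e h y n → a :* (t :* ((e :* h) :* y :* n)) := (t :* h) :* ((a :* y) :* (e :* n))) refl
  Ay≤1 : ⟦ A ⟧ * y ≤ 1ℚ
  Ay≤1 = ℚ.≤-trans (*-monoʳ y (^-nonNeg 0≤x (2 ℕ.* k)) (⟦⟧-mono-≤ (2^4k≤16^2k k))) (scaled-^≤1 0≤x 16 16x≤1 (2 ℕ.* k))

-- Assembly of the theorem

noMCM-completion : ∀ {k M N} (G : ColGraph k M) t D → 0ℚ < t → NoMCM G t →
  (∀ u → length (nonNeighbours G u) ℕ.≤ D) → N ℕ.+ 2 ^ (k ℕ.* 4) ℕ.* (2 ℕ.* D) ℕ.≤ M →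
  Σ (ColGraph k N) λ G′ → Complete G′ × NoMCM G′ t × Extends G G′
noMCM-completion {M = M} {N} G t D 0<t noMCM dense enough =
  -- The largest s with 2s < t; 0 qualifies because t is positive, and the search may stop at `M`
  -- since no matching has more edges.
  let s , s-small , s-max = largest (λ j → ¬? (t ℚ.≤? ⟦ 2 ℕ.* j ⟧)) (λ t≤0 → ℚ.<-irrefl refl (ℚ.<-≤-trans 0<t t≤0)) M
      bounded : (m : MonoConnMatching G) → length (MonoConnMatching.edges m) ℕ.≤ s
      bounded m = s-max _ (length≤M (MonoConnMatching.coloured m , MonoConnMatching.disjoint m)) (noMCM m)
      G′ , complete , bound , extends = Completion.completion G s D bounded dense N enough
  in G′ , complete , (λ m big → s-small (ℚ.≤-trans big (⟦⟧-mono-≤ (ℕ.*-monoʳ-≤ 2 (bound m))))) , extends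

dense-completion : ∀ k ε n N δ t x {M} (G : ColGraph k M) →
  0ℚ ≤ x → ⟦ 16 ⟧ * x ≤ 1ℚ → δ ≡ (ε * ℚ.½) * (x Defs.^ (2 ℕ.* k)) → 0ℚ ≤ ε → 0ℚ ≤ n → 0ℚ < t →
  ⟦ N ⟧ + ε * n ≤ ⟦ M ⟧ → (∀ u → ⟦ length (nonNeighbours G u) ⟧ ≤ δ * n) → NoMCM G t →
  Σ (ColGraph k N) λ G′ → Complete G′ × NoMCM G′ t × Extends G G′
dense-completion k ε n N δ t x {M} G 0≤x 16x≤1 eq 0≤ε 0≤n 0<t large dense noMCM =
  -- An integer version of δn, capped at `M`, which bounds every list of non-neighbours anyway.
  let D , D-small , D-max = largest (λ j → ⟦ j ⟧ ℚ.≤? δ * n) (*-nonNeg 0≤δ 0≤n) M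
  in noMCM-completion G t D 0<t noMCM (λ u → D-max _ (NN≤M u) (dense u)) (⟦⟧-cancel-≤ (enough D D-small))
  where
  0≤δ : 0ℚ ≤ δ
  0≤δ = subst (0ℚ ≤_) (sym eq) (*-nonNeg (*-nonNeg 0≤ε (ℚ.nonNegative⁻¹ ℚ.½)) (^-nonNeg 0≤x (2 ℕ.* k)))

  NN≤M : ∀ u → length (nonNeighbours G u) ℕ.≤ M
  NN≤M u = ℕ.≤-trans (length-filter _ (allFin M)) (ℕ.≤-reflexive (length-tabulate id))

  enough : ∀ D → ⟦ D ⟧ ≤ δ * n → ⟦ N ℕ.+ 2 ^ (k ℕ.* 4) ℕ.* (2 ℕ.* D) ⟧ ≤ ⟦ M ⟧
  enough D D-small = begin
    ⟦ N ℕ.+ 2 ^ (k ℕ.* 4) ℕ.* (2 ℕ.* D) ⟧     ≡⟨ ⟦⟧-+ N _ ⟩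
    ⟦ N ⟧ + ⟦ 2 ^ (k ℕ.* 4) ℕ.* (2 ℕ.* D) ⟧   ≤⟨ ℚ.+-monoʳ-≤ ⟦ N ⟧ (deletions≤ k ε n D δ x 0≤x 16x≤1 eq 0≤ε 0≤n D-small) ⟩
    ⟦ N ⟧ + ε * n                             ≤⟨ large ⟩
    ⟦ M ⟧                                     ∎
    where open ℚ.≤-Reasoning

theorem2p1 : (k : ℕ) → 1 ℕ.≤ k → (α β : ℚ) → 0ℚ < α → (α≤β : α ≤ β) →
    Σ ℚ λ ε₀ → 0ℚ < ε₀ ×
    ((ε : ℚ) → 0ℚ < ε → ε ≤ ε₀ →
    (n : ℚ) → 0ℚ < n → (N : ℕ) → 1 ℕ.≤ N → ⟦ N ⟧ ≤ β * n →
    (M : ℕ) (G : ColGraph k M) →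
    ⟦ N ⟧ + ε * n ≤ ⟦ M ⟧ →
    (β>0 : 0ℚ < β) →
    (∀ u → ⟦ length (nonNeighbours G u) ⟧ ≤ delta k α β ε β>0 * n) →
    NoMCM G (α * n) →
    Σ (ColGraph k N) λ G′ → Complete G′ × NoMCM G′ (α * n) ×
    Σ (Fin N → Fin M) λ f → Injective _≡_ _≡_ f ×
    (∀ i j ℓ → col G (f i) (f j) ≡ just ℓ → col G′ i j ≡ just ℓ))
-- For ε₀ an arbitrary positive number is chosen, here 1.
theorem2p1 k _ α β 0<α α≤β = 1ℚ , ℚ.positive⁻¹ 1ℚ ,
  λ ε 0<ε _ n 0<n N _ _ M G large β>0 dense noMCM →
    let x , 0≤x , 16x≤1 , eq = delta-form k α β ε 0<α α≤β β>0
        αn>0 = ℚ.positive⁻¹ (α * n) {{ℚ.pos*pos⇒pos α {{ℚ.positive 0<α}} n {{ℚ.positive 0<n}}}}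
    in dense-completion k ε n N (delta k α β ε β>0) (α * n) x G 0≤x 16x≤1 eq (ℚ.<⇒≤ 0<ε) (ℚ.<⇒≤ 0<n) αn>0
         large dense noMCM
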